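{- For any fan poset $P=\mathcal V(\ell_1,\ldots,\ell_k)$ with $\ell_1\ge\cdots\ge\ell_k\ge2$, the limit $\pi(P)=\lim_{n\to\infty}\mathrm{La}(n,P)/\binom{n}{\lfloor n/2\rfloor}$ exists and $\pi(P)=e(P)=\ell_1-1$.
   Context: All posets are finite and nonempty. Let $[n]=\{1,\dots,n\}$; families of subsets of $[n]$ are ordered by inclusion. A poset $(P,\le)$ contains a poset $(P',\le')$ as a (weak) subposet if there is an injection $f:P'\to P$ such that $u\le' v$ implies $f(u)\le f(v)$. A family $\mathcal F\subseteq 2^{[n]}$ is $P$-free if it does not contain $P$ in this sense. $\mathrm{La}(n,P)$ is the largest size of a $P$-free family $\mathcal F\subseteq 2^{[n]}$. $e(P)$ is the maximum integer $k\ge 0$ such that for all integers $n$ and $s$ the family $\binom{[n]}{s}\cup\binom{[n]}{s+1}\cup\cdots\cup\binom{[n]}{s+k-1}$ is $P$-free, where $\binom{[n]}{j}$ is the collection of $j$-element subsets of $[n]$ (empty if $j<0$ or $j>n$). Let $\mathcal P_\ell$ denote the chain with $\ell$ elements. For $k\ge1$ and $\ell_1\ge\cdots\ge\ell_k\ge2$, the fan $\mathcal V(\ell_1,\ldots,\ell_k)$ is the poset obtained from disjoint chains $\mathcal P_{\ell_1},\ldots,\mathcal P_{\ell_k}$ by identifying their minimum elements (elements of different chains other than the common minimum are incomparable). -}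

module Defs where

open import Level using (0ℓ)
open import Data.Fin.Base as Fin using (Fin; toℕ)
import Data.Fin.Properties as Fin
open import Data.Fin.Subset using (Subset; ∣_∣)
open import Data.Fin.Subset.Properties using (⊆-poset)
open import Data.Integer.Base as ℤ using (ℤ; +_)
open import Data.List.Base using (List; length)
open import Data.List.Membership.Propositional using (_∈_)
open import Data.List.Relation.Unary.Unique.Propositional using (Unique)
open import Data.Nat.Base
open import Data.Nat.Combinatorics using (_C_; nCn≡1; nCk≡nC[n∸k]; nCk+nC[k+1]≡[n+1]C[k+1])
open import Data.Nat.Properties using (⌊n/2⌋≤n; ≤-trans; m≤m+n; ≤-reflexive)
open import Data.Product.Base using (_×_; proj₁; Σ-syntax; ∃-syntax)
open import Data.Rational.Base as ℚ using (ℚ; 0ℚ)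
open import Function.Definitions using (Injective)
open import Relation.Binary.Bundles using (Poset)
import Relation.Binary.Construct.On as On
open import Relation.Binary.Morphism.Bundles using (PosetHomomorphism)
open import Relation.Binary.PropositionalEquality
  using (_≡_; refl; sym; trans; isEquivalence)
open import Relation.Nullary.Negation using (¬_)
open import Relation.Unary using (Pred; ⋃)

FamilyPoset : ∀ {n} → Pred (Subset n) 0ℓ → Poset 0ℓ 0ℓ 0ℓ
FamilyPoset {n} 𝓕 = On.poset (⊆-poset n) (proj₁ {B = 𝓕})

-- Weak containment: order relations are preserved but need not be reflected.
_⊑_ : Poset 0ℓ 0ℓ 0ℓ → Poset 0ℓ 0ℓ 0ℓ → Set
P ⊑ Q = Σ[ f ∈ PosetHomomorphism P Q ]
          Injective (Poset._≈_ P) (Poset._≈_ Q) (PosetHomomorphism.⟦_⟧ f)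

_-free_ : Poset 0ℓ 0ℓ 0ℓ → ∀ {n} → Pred (Subset n) 0ℓ → Set
P -free 𝓕 = ¬ (P ⊑ FamilyPoset 𝓕)

IsMaximum : Pred ℕ 0ℓ → ℕ → Set
IsMaximum A m = A m × (∀ k → A k → k ≤ m)

-- A family whose size matters is given by a duplicate-free list of its members.
FreeFamilySize : Poset 0ℓ 0ℓ 0ℓ → ℕ → Pred ℕ 0ℓ
FreeFamilySize P n m =
  Σ[ 𝓕 ∈ List (Subset n) ] Unique 𝓕 × (P -free (_∈ 𝓕)) × length 𝓕 ≡ m

-- La(n,P), as the relation "m is the value of La(n,P)".
IsLa : Poset 0ℓ 0ℓ 0ℓ → ℕ → ℕ → Set
IsLa P n = IsMaximum (FreeFamilySize P n)

-- The index is an integer; layers outside 0,…,n are empty.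
Layer : ∀ {n} → ℤ → Pred (Subset n) 0ℓ
Layer j A = + ∣ A ∣ ≡ j

Layers : ∀ {n} → ℤ → ℕ → Pred (Subset n) 0ℓ
Layers s k = ⋃[ i ∶ Fin k ] Layer (s ℤ.+ + toℕ i)

-- e(P), as the relation "k is the value of e(P)".
IsE : Poset 0ℓ 0ℓ 0ℓ → ℕ → Set
IsE P = IsMaximum (λ k → ∀ (n : ℕ) (s : ℤ) → P -free (Layers {n} s k))

nCk>0 : ∀ {n k} → k ≤ n → 0 < n C k
nCk>0 {n} {zero} _ =
  ≤-reflexive (sym (trans (nCk≡nC[n∸k] {0} {n} z≤n) (nCn≡1 n)))
nCk>0 {suc n} {suc k} (s≤s k≤n) =
  ≤-trans (nCk>0 k≤n)
    (≤-trans (m≤m+n (n C k) (n C suc k))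
             (≤-reflexive (nCk+nC[k+1]≡[n+1]C[k+1] n k)))

-- La(n,P) / (n choose ⌊n/2⌋), for a function La of n.
ratio : (ℕ → ℕ) → ℕ → ℚ
ratio La n = + La n ℚ./ (n C ⌊ n /2⌋)
  where instance _ = >-nonZero (nCk>0 (⌊n/2⌋≤n n))

_⟶_ : (ℕ → ℚ) → ℚ → Set
a ⟶ L = ∀ (ε : ℚ) → 0ℚ ℚ.< ε →
          ∃[ N ] (∀ n → N ≤ n → ℚ.∣ a n ℚ.- L ∣ ℚ.< ε)

-- "π(P) exists and equals L".  La is determined by IsLa, so asserting that it
-- exists adds only that the maxima defining La(n,P) are attained.
Isπ : Poset 0ℓ 0ℓ 0ℓ → ℚ → Set
Isπ P L = Σ[ La ∈ (ℕ → ℕ) ]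
            (∀ n → IsLa P n (La n)) ×
            (ratio La ⟶ L)

-- The fan 𝒱(ℓ₁,…,ℓₖ): the i-th chain consists of the common minimum and
-- ℓᵢ - 1 further elements node i 0 < node i 1 < ….
data Fan {k} (ℓ : Fin k → ℕ) : Set where
  root : Fan ℓ
  node : (i : Fin k) → Fin (ℓ i ∸ 1) → Fan ℓ

data _≤ᶠ_ {k} {ℓ : Fin k → ℕ} : Fan ℓ → Fan ℓ → Set where
  root≤ : ∀ {x} → root ≤ᶠ x
  node≤ : ∀ {i a b} → a Fin.≤ b → node i a ≤ᶠ node i b

fan : ∀ {k} → (Fin k → ℕ) → Poset 0ℓ 0ℓ 0ℓ
fan ℓ = record
  { Carrier        = Fan ℓ
  ; _≈_            = _≡_
  ; _≤_            = _≤ᶠ_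
  ; isPartialOrder = record
    { isPreorder = record
      { isEquivalence = isEquivalence
      ; reflexive     = λ { refl → ≤ᶠ-refl }
      ; trans         = ≤ᶠ-trans
      }
    ; antisym = ≤ᶠ-antisym
    }
  }
  where
  ≤ᶠ-refl : ∀ {x : Fan ℓ} → x ≤ᶠ x
  ≤ᶠ-refl {root}     = root≤
  ≤ᶠ-refl {node i a} = node≤ (Fin.≤-refl {x = a})

  ≤ᶠ-trans : ∀ {x y z : Fan ℓ} → x ≤ᶠ y → y ≤ᶠ z → x ≤ᶠ z
  ≤ᶠ-trans root≤     _         = root≤
  ≤ᶠ-trans (node≤ {a = a} {b} p) (node≤ {b = c} q) =
    node≤ (Fin.≤-trans {i = a} {b} {c} p q)

  ≤ᶠ-antisym : ∀ {x y : Fan ℓ} → x ≤ᶠ y → y ≤ᶠ x → x ≡ y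
  ≤ᶠ-antisym root≤     root≤     = refl
  ≤ᶠ-antisym (node≤ p) (node≤ q) with Fin.≤-antisym p q
  ... | refl = refl

{-# OPTIONS --safe #-}

-- Let h + 1 be the length of the longest of the k chains.  An (h + 1)-chain does not fit into h
-- consecutive layers, so the h layers from ⌊n/2⌋ upwards give the lower bound for π.
--
-- For the upper bound let A be a member of a fan-free family 𝓕.  A maximal collection of disjoint
-- h-chains of 𝓕 above A has fewer than k members, so at most c = k h sets block every h-chain of 𝓕
-- above A.  A random path of covers from A to the full set meets a given proper superset B ≠ [n] of
-- A with probability 1 / C(n - ∣A∣, ∣B∣ - ∣A∣) ≤ 1 / (n - ∣A∣); hence with probability at least
-- 1 - c / (n - ∣A∣) it has fewer than h members of 𝓕 above A.  A full chain contains at most h such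
-- A, so summing over A gives Σ (1 - c / (n - ∣A∣)) / C(n,∣A∣) ≤ h.  The sets with n - ∣A∣ < m, for
-- a constant m, are asymptotically negligible.
module Submission where

open import Defs
import Data.Bool.Properties as Bool
open import Data.Fin.Base as Fin using (Fin; toℕ)
import Data.Fin.Properties as Fin
open import Data.Fin.Subset as Sub using (Subset; inside; outside; ∣_∣; _⊆_; _⊂_; ⊥; ⁅_⁆)
open import Data.Fin.Subset.Properties
  using (_⊂?_; _⊆?_; anySubset?; p⊆q⇒∣p∣≤∣q∣; ∣p∣≤n; drop-∷-⊆; out⊂in; s⊂s; s⊆s;
         ⊂-trans; ⊂-irref; ⊆-refl; ⊥⊆; ∣⊥∣≡0; ∣⁅x⁆∣≡1; x∈⁅x⁆; x∈⁅y⁆⇒x≡y)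
open import Data.Integer.Base as ℤ using (ℤ)
import Data.Integer.Properties as ℤ
open import Data.Integer.Tactic.RingSolver using (solve-∀)
open import Data.List.Base as List
  using (List; []; _∷_; _++_; map; length; downFrom; concatMap; filter; tabulate)
open import Data.List.Membership.Propositional using (_∈_; _∉_; find; lose)
open import Data.List.Membership.Propositional.Properties
  using (∈-map⁺; ∈-map⁻; ∈-++⁺ˡ; ∈-++⁺ʳ; ∈-++⁻; ∈-∃++; ∈-concatMap⁺; ∈-concatMap⁻;
         ∈-downFrom⁺; ∈-downFrom⁻; ∈-filter⁺)
open import Data.List.Properties
  using (length-map; length-++; length-++-comm; length-downFrom; length-tabulate;
         tabulate-cong; tabulate-lookup)
open import Data.List.Relation.Unary.All as All using (All; []; _∷_)
open import Data.List.Relation.Unary.All.Properties using (++⁺; ¬Any⇒All¬)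
open import Data.List.Relation.Unary.AllPairs using ([]; _∷_)
open import Data.List.Relation.Unary.Any using (here; there; any?)
open import Data.List.Relation.Unary.Linked using (Linked; [-]; _∷_)
open import Data.List.Relation.Unary.Unique.Propositional using (Unique)
import Data.List.Relation.Unary.Unique.Propositional.Properties as Unique
open import Data.Nat.Base hiding (_/_)
open import Data.Nat.Combinatorics
  using (_C_; nCn≡1; nCk≡nC[n∸k]; nCk+nC[k+1]≡[n+1]C[k+1]; nCk≡n!/k![n-k]!; k![n∸k]!∣n!; k>n⇒nCk≡0)
open import Data.Nat.DivMod using (m/n*n≡m)
open import Data.Nat.Properties
open import Data.Nat.Solver using (module +-*-Solver)
open import Data.Product.Base using (_×_; _,_; proj₁; proj₂; ∃; ∃-syntax)
open import Data.Rational.Base as ℚ using (ℚ; mkℚ; 0ℚ)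
import Data.Rational.Properties as ℚ
open import Data.Rational.Unnormalised.Base as ℚᵘ using (mkℚᵘ; *<*)
import Data.Rational.Unnormalised.Properties as ℚᵘ
open import Data.Sum.Base using (_⊎_; inj₁; inj₂)
open import Data.Vec.Base as Vec using (Vec; []; _∷_; toList; lookup; here; there)
import Data.Vec.Properties as Vec
open import Function.Base using (_∘_; id)
open import Level using (0ℓ)
open import Relation.Binary.Core using (Rel)
open import Relation.Binary.Definitions
  using (DecidableEquality; Reflexive; _Respects_; tri<; tri≈; tri>)
open import Relation.Binary.Morphism.Bundles using (PosetHomomorphism)
open import Relation.Binary.PropositionalEquality hiding (resp)
open import Relation.Nullary.Decidable using (Dec; yes; no; map′; _×-dec_; _→-dec_; ¬?)
open import Relation.Nullary.Negation using (¬_; contradiction)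
open import Relation.Unary using (Pred; Decidable)

private variable
  n : ℕ
  X Y : Set

-- Indicators and finite sums over lists.

𝟙 : {P : Set} → Dec P → ℕ
𝟙 (yes _) = 1
𝟙 (no  _) = 0

𝟙-yes : {P : Set} (P? : Dec P) → P → 𝟙 P? ≡ 1
𝟙-yes (yes _) _ = refl
𝟙-yes (no ¬p) p = contradiction p ¬p

𝟙-no : {P : Set} (P? : Dec P) → ¬ P → 𝟙 P? ≡ 0
𝟙-no (yes p) ¬p = contradiction p ¬p
𝟙-no (no _)  _  = refl

∑ : List X → (X → ℕ) → ℕ
∑ []       f = 0
∑ (x ∷ xs) f = f x + ∑ xs f

∑-mono : ∀ (xs : List X) {f g} → (∀ {x} → x ∈ xs → f x ≤ g x) → ∑ xs f ≤ ∑ xs g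
∑-mono []       f≤g = z≤n
∑-mono (x ∷ xs) f≤g = +-mono-≤ (f≤g (here refl)) (∑-mono xs (f≤g ∘ there))

∑-cong : ∀ (xs : List X) {f g} → (∀ {x} → x ∈ xs → f x ≡ g x) → ∑ xs f ≡ ∑ xs g
∑-cong []       f≡g = refl
∑-cong (x ∷ xs) f≡g = cong₂ _+_ (f≡g (here refl)) (∑-cong xs (f≡g ∘ there))

∑-++ : ∀ (xs : List X) {ys} f → ∑ (xs ++ ys) f ≡ ∑ xs f + ∑ ys f
∑-++ []       f = refl
∑-++ (x ∷ xs) f = trans (cong (f x +_) (∑-++ xs f)) (sym (+-assoc (f x) _ _))

∑-map : ∀ (g : X → Y) xs f → ∑ (map g xs) f ≡ ∑ xs (f ∘ g)
∑-map g []       f = refl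
∑-map g (x ∷ xs) f = cong (f (g x) +_) (∑-map g xs f)

∑-+ : ∀ (xs : List X) f g → ∑ xs (λ x → f x + g x) ≡ ∑ xs f + ∑ xs g
∑-+ []       f g = refl
∑-+ (x ∷ xs) f g rewrite ∑-+ xs f g =
  solve 4 (λ a b c d → (a :+ b) :+ (c :+ d) := (a :+ c) :+ (b :+ d)) refl (f x) (g x) (∑ xs f) (∑ xs g)
  where open +-*-Solver

∑-*ʳ : ∀ (xs : List X) f c → ∑ xs (λ x → f x * c) ≡ ∑ xs f * c
∑-*ʳ []       f c = refl
∑-*ʳ (x ∷ xs) f c = trans (cong (f x * c +_) (∑-*ʳ xs f c)) (sym (*-distribʳ-+ c (f x) _))

∑-const : ∀ (xs : List X) c → ∑ xs (λ _ → c) ≡ length xs * c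
∑-const []       c = refl
∑-const (x ∷ xs) c = cong (c +_) (∑-const xs c)

-- Covers and layers of the Boolean lattice.

covers : Subset n → List (Subset n)
covers []            = []
covers (inside  ∷ A) = map (inside ∷_) (covers A)
covers (outside ∷ A) = (inside ∷ A) ∷ map (outside ∷_) (covers A)

layer : ∀ n → ℕ → List (Subset n)
layer zero    zero    = [] ∷ []
layer zero    (suc k) = []
layer (suc n) zero    = map (outside ∷_) (layer n zero)
layer (suc n) (suc k) = map (inside ∷_) (layer n k) ++ map (outside ∷_) (layer n (suc k))

∈-covers⇒⊂ : ∀ (A : Subset n) {B} → B ∈ covers A → A ⊂ B
∈-covers⇒⊂ (inside ∷ A) B∈ with ∈-map⁻ _ B∈
... | B′ , B′∈ , refl = s⊂s (∈-covers⇒⊂ A B′∈)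
∈-covers⇒⊂ (outside ∷ A) (here refl) = out⊂in ⊆-refl
∈-covers⇒⊂ (outside ∷ A) (there B∈) with ∈-map⁻ _ B∈
... | B′ , B′∈ , refl = s⊂s (∈-covers⇒⊂ A B′∈)

∣cover∣ : ∀ (A : Subset n) {B} → B ∈ covers A → ∣ B ∣ ≡ suc ∣ A ∣
∣cover∣ (inside ∷ A) B∈ with ∈-map⁻ _ B∈
... | B′ , B′∈ , refl = cong suc (∣cover∣ A B′∈)
∣cover∣ (outside ∷ A) (here refl) = refl
∣cover∣ (outside ∷ A) (there B∈) with ∈-map⁻ _ B∈
... | B′ , B′∈ , refl = ∣cover∣ A B′∈

∣A∣+∣covers∣ : ∀ (A : Subset n) → ∣ A ∣ + length (covers A) ≡ n
∣A∣+∣covers∣ []            = refl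
∣A∣+∣covers∣ (inside  ∷ A) =
  cong suc (trans (cong (∣ A ∣ +_) (length-map _ (covers A))) (∣A∣+∣covers∣ A))
∣A∣+∣covers∣ (outside ∷ A) = trans (+-suc ∣ A ∣ _)
  (cong suc (trans (cong (∣ A ∣ +_) (length-map _ (covers A))) (∣A∣+∣covers∣ A)))

-- Double counting: a set with k + 1 elements covers exactly k + 1 sets of layer k, so its value of
-- `φ` occurs k + 1 times on the left. The induction splits on whether the first element of the
-- ground set belongs to the set.
∑-covers-layer : ∀ n k (φ : Subset n → ℕ) →
  ∑ (layer n k) (λ A → ∑ (covers A) φ) ≡ suc k * ∑ (layer n (suc k)) φ
∑-covers-layer zero    zero    φ = refl
∑-covers-layer zero    (suc k) φ = sym (*-zeroʳ k)
∑-covers-layer (suc n) k φ = begin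
  ∑ (layer (suc n) k) (λ A → ∑ (covers A) φ)
    ≡⟨ split k ⟩
  k * ∑ (layer n k) φ∈ + (∑ (layer n k) φ∈ + ∑ (layer n k) (λ A → ∑ (covers A) φ∉))
    ≡⟨ cong (λ s → k * ∑ (layer n k) φ∈ + (∑ (layer n k) φ∈ + s)) (∑-covers-layer n k φ∉) ⟩
  k * ∑ (layer n k) φ∈ + (∑ (layer n k) φ∈ + suc k * ∑ (layer n (suc k)) φ∉)
    ≡⟨ solve 3 (λ k a b → k :* a :+ (a :+ (con 1 :+ k) :* b) := (con 1 :+ k) :* (a :+ b)) refl
         k (∑ (layer n k) φ∈) (∑ (layer n (suc k)) φ∉) ⟩
  suc k * (∑ (layer n k) φ∈ + ∑ (layer n (suc k)) φ∉)
    ≡⟨ cong (suc k *_) (cong₂ _+_ (∑-map _ (layer n k) φ) (∑-map _ (layer n (suc k)) φ)) ⟨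
  suc k * (∑ (map (inside ∷_) (layer n k)) φ + ∑ (map (outside ∷_) (layer n (suc k))) φ)
    ≡⟨ cong (suc k *_) (∑-++ (map (inside ∷_) (layer n k)) φ) ⟨
  suc k * ∑ (layer (suc n) (suc k)) φ ∎
  where
  open ≡-Reasoning
  open +-*-Solver
  φ∈ φ∉ : Subset n → ℕ
  φ∈ = φ ∘ (inside ∷_)
  φ∉ = φ ∘ (outside ∷_)

  out : ∀ k → ∑ (map (outside ∷_) (layer n k)) (λ A → ∑ (covers A) φ)
            ≡ ∑ (layer n k) φ∈ + ∑ (layer n k) (λ A → ∑ (covers A) φ∉)
  out k = trans (∑-map _ (layer n k) _)
    (trans (∑-cong (layer n k) (λ {A} _ → cong (φ∈ A +_) (∑-map _ (covers A) φ)))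
           (∑-+ (layer n k) φ∈ _))

  split : ∀ k → ∑ (layer (suc n) k) (λ A → ∑ (covers A) φ)
    ≡ k * ∑ (layer n k) φ∈ + (∑ (layer n k) φ∈ + ∑ (layer n k) (λ A → ∑ (covers A) φ∉))
  split zero    = out zero
  split (suc k) = trans (∑-++ (map (inside ∷_) (layer n k)) _) (cong₂ _+_
    (trans (∑-map _ (layer n k) _)
      (trans (∑-cong (layer n k) (λ {A} _ → ∑-map _ (covers A) φ)) (∑-covers-layer n k φ∈)))
    (out (suc k)))

𝟙-mono : {P Q : Set} (P? : Dec P) (Q? : Dec Q) → (P → Q) → 𝟙 P? ≤ 𝟙 Q?
𝟙-mono (no _)  Q? f = z≤n
𝟙-mono (yes p) Q? f = ≤-reflexive (sym (𝟙-yes Q? (f p)))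

-- A cover of A inside B arises by adding one element of B that is not in A; if A is not contained
-- in B, there is none.
∑-covers-⊆ : ∀ (A B : Subset n) → ∑ (covers A) (λ A′ → 𝟙 (A′ ⊆? B)) ≤ ∣ B ∣ ∸ ∣ A ∣
∑-covers-⊆ [] [] = z≤n
∑-covers-⊆ (inside ∷ A) (inside ∷ B) = begin
  ∑ (map (inside ∷_) (covers A)) (λ A′ → 𝟙 (A′ ⊆? (inside ∷ B))) ≡⟨ ∑-map _ (covers A) _ ⟩
  ∑ (covers A) (λ A′ → 𝟙 ((inside ∷ A′) ⊆? (inside ∷ B)))
    ≤⟨ ∑-mono (covers A) (λ {A′} _ → 𝟙-mono ((inside ∷ A′) ⊆? (inside ∷ B)) (A′ ⊆? B) drop-∷-⊆) ⟩
  ∑ (covers A) (λ A′ → 𝟙 (A′ ⊆? B))                              ≤⟨ ∑-covers-⊆ A B ⟩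
  ∣ B ∣ ∸ ∣ A ∣ ∎
  where open ≤-Reasoning
∑-covers-⊆ (inside ∷ A) (outside ∷ B) = begin
  ∑ (map (inside ∷_) (covers A)) (λ A′ → 𝟙 (A′ ⊆? (outside ∷ B))) ≡⟨ ∑-map _ (covers A) _ ⟩
  ∑ (covers A) (λ A′ → 𝟙 ((inside ∷ A′) ⊆? (outside ∷ B)))
    ≡⟨ ∑-cong (covers A) (λ {A′} _ → 𝟙-no ((inside ∷ A′) ⊆? (outside ∷ B)) λ p → in⊈out (p here)) ⟩
  ∑ (covers A) (λ _ → 0)                                         ≡⟨ ∑-const (covers A) 0 ⟩
  length (covers A) * 0                                          ≡⟨ *-zeroʳ (length (covers A)) ⟩
  0                                                              ≤⟨ z≤n ⟩
  ∣ B ∣ ∸ suc ∣ A ∣ ∎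
  where
  open ≤-Reasoning
  in⊈out : ¬ (Fin.zero Sub.∈ (outside ∷ B))
  in⊈out ()
∑-covers-⊆ (outside ∷ A) (b ∷ B) = ≤-trans (+-monoʳ-≤ (𝟙 ((inside ∷ A) ⊆? (b ∷ B))) tail) (head b)
  where
  open ≤-Reasoning
  tail : ∑ (map (outside ∷_) (covers A)) (λ A′ → 𝟙 (A′ ⊆? (b ∷ B))) ≤ ∣ B ∣ ∸ ∣ A ∣
  tail = begin
    ∑ (map (outside ∷_) (covers A)) (λ A′ → 𝟙 (A′ ⊆? (b ∷ B))) ≡⟨ ∑-map _ (covers A) _ ⟩
    ∑ (covers A) (λ A′ → 𝟙 ((outside ∷ A′) ⊆? (b ∷ B)))
      ≤⟨ ∑-mono (covers A) (λ {A′} _ → 𝟙-mono ((outside ∷ A′) ⊆? (b ∷ B)) (A′ ⊆? B) drop-∷-⊆) ⟩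
    ∑ (covers A) (λ A′ → 𝟙 (A′ ⊆? B))                          ≤⟨ ∑-covers-⊆ A B ⟩
    ∣ B ∣ ∸ ∣ A ∣ ∎

  head : ∀ b → 𝟙 ((inside ∷ A) ⊆? (b ∷ B)) + (∣ B ∣ ∸ ∣ A ∣) ≤ ∣ b ∷ B ∣ ∸ ∣ A ∣
  head outside = ≤-reflexive refl
  head inside with (inside ∷ A) ⊆? (inside ∷ B)
  ... | no  _ = ∸-monoˡ-≤ ∣ A ∣ (n≤1+n ∣ B ∣)
  -- A ⊆ B keeps the subtraction from being truncated, so the cover through the first element is
  -- paid for by the larger B.
  ... | yes p = ≤-reflexive (sym (+-∸-assoc 1 (p⊆q⇒∣p∣≤∣q∣ (drop-∷-⊆ p))))

-- Sums over paths of covers.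

-- Sums s over the d-step paths of covers from A; such a path is recorded without its start A.
∑-paths : ℕ → Subset n → (List (Subset n) → ℕ) → ℕ
∑-paths zero    A s = s []
∑-paths (suc d) A s = ∑ (covers A) (λ B → ∑-paths d B (s ∘ (B ∷_)))

-- The steps need not be covers, so the predicate applies both to paths and to the chains extracted
-- from them.
Ascends : Subset n → Pred (List (Subset n)) 0ℓ
Ascends A p = Linked _⊂_ (A ∷ p)

∑-paths-mono : ∀ d (A : Subset n) {s t} → (∀ p → Ascends A p → s p ≤ t p) →
  ∑-paths d A s ≤ ∑-paths d A t
∑-paths-mono zero    A s≤t = s≤t [] [-]
∑-paths-mono (suc d) A s≤t = ∑-mono (covers A) λ {B} B∈ →
  ∑-paths-mono d B λ p asc → s≤t (B ∷ p) (∈-covers⇒⊂ A B∈ ∷ asc)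

∑-paths-cong : ∀ d (A : Subset n) {s t} → (∀ p → Ascends A p → s p ≡ t p) →
  ∑-paths d A s ≡ ∑-paths d A t
∑-paths-cong d A s≡t = ≤-antisym
  (∑-paths-mono d A λ p asc → ≤-reflexive (s≡t p asc))
  (∑-paths-mono d A λ p asc → ≤-reflexive (sym (s≡t p asc)))

∑-paths-+ : ∀ d (A : Subset n) s t →
  ∑-paths d A (λ p → s p + t p) ≡ ∑-paths d A s + ∑-paths d A t
∑-paths-+ zero    A s t = refl
∑-paths-+ (suc d) A s t = trans
  (∑-cong (covers A) λ {B} _ → ∑-paths-+ d B (s ∘ (B ∷_)) (t ∘ (B ∷_)))
  (∑-+ (covers A) _ _)

-- The hypothesis makes the paths end at the full set. With d elements missing there are d first
-- steps, and each leaves d - 1 missing elements, hence d ! paths.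
∑-paths-const : ∀ d (A : Subset n) c → ∣ A ∣ + d ≡ n → ∑-paths d A (λ _ → c) ≡ d ! * c
∑-paths-const zero    A c eq = sym (*-identityˡ c)
∑-paths-const (suc d) A c eq = begin
  ∑ (covers A) (λ B → ∑-paths d B (λ _ → c))
    ≡⟨ ∑-cong (covers A) (λ {B} B∈ → ∑-paths-const d B c
         (trans (cong (_+ d) (∣cover∣ A B∈)) (trans (sym (+-suc ∣ A ∣ d)) eq))) ⟩
  ∑ (covers A) (λ _ → d ! * c)       ≡⟨ ∑-const (covers A) (d ! * c) ⟩
  length (covers A) * (d ! * c)      ≡⟨ cong (_* (d ! * c)) (+-cancelˡ-≡ ∣ A ∣ _ _ (trans (∣A∣+∣covers∣ A) (sym eq))) ⟩
  suc d * (d ! * c)                  ≡⟨ *-assoc (suc d) (d !) c ⟨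
  suc d ! * c ∎
  where open ≡-Reasoning

∑-paths-zero : ∀ d (A : Subset n) → ∑-paths d A (λ _ → 0) ≡ 0
∑-paths-zero zero    A = refl
∑-paths-zero (suc d) A = trans (∑-cong (covers A) (λ {B} _ → ∑-paths-zero d B))
  (trans (∑-const (covers A) 0) (*-zeroʳ (length (covers A))))

∑-paths-∑ : ∀ d (A : Subset n) (xs : List X) (s : X → List (Subset n) → ℕ) →
  ∑-paths d A (λ p → ∑ xs (λ x → s x p)) ≡ ∑ xs (λ x → ∑-paths d A (s x))
∑-paths-∑ d A []       s = ∑-paths-zero d A
∑-paths-∑ d A (x ∷ xs) s = trans (∑-paths-+ d A (s x) _)
  (cong (∑-paths d A (s x) +_) (∑-paths-∑ d A xs s))

_≟ˢ_ : DecidableEquality (Subset n)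
_≟ˢ_ = Vec.≡-dec Bool._≟_

_∈ˢ?_ : ∀ (A : Subset n) 𝓕 → Dec (A ∈ 𝓕)
_∈ˢ?_ = _∈?_ where open import Data.List.Membership.DecPropositional _≟ˢ_

ascends⇒⊂ : ∀ {A B : Subset n} {p} → Ascends A p → B ∈ p → A ⊂ B
ascends⇒⊂ (A⊂C ∷ asc) (here refl) = A⊂C
ascends⇒⊂ (A⊂C ∷ asc) (there B∈p) = ⊂-trans A⊂C (ascends⇒⊂ asc B∈p)

ascends-shorten : ∀ {A B : Subset n} {p} → A ⊂ B → Ascends B p → Ascends A p
ascends-shorten A⊂B [-]         = [-]
ascends-shorten A⊂B (B⊂C ∷ asc) = ⊂-trans A⊂B B⊂C ∷ asc

𝟙-≤1 : {P : Set} (P? : Dec P) → 𝟙 P? ≤ 1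
𝟙-≤1 (yes _) = ≤-refl
𝟙-≤1 (no  _) = z≤n

∑-paths-𝟙 : ∀ d (A : Subset n) {P : List (Subset n) → Set} (P? : ∀ p → Dec (P p)) →
  ∣ A ∣ + d ≡ n → ∑-paths d A (𝟙 ∘ P?) ≤ d !
∑-paths-𝟙 d A P? eq = begin
  ∑-paths d A (𝟙 ∘ P?)   ≤⟨ ∑-paths-mono d A (λ p _ → 𝟙-≤1 (P? p)) ⟩
  ∑-paths d A (λ _ → 1)  ≡⟨ ∑-paths-const d A 1 eq ⟩
  d ! * 1                ≡⟨ *-identityʳ (d !) ⟩
  d ! ∎
  where open ≤-Reasoning

-- This is the probability bound 1 / (n - ∣A∣), multiplied by the number of paths. A path can meet B
-- only if its first step stays inside B. If B is a cover of A, a single first step does so;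
-- otherwise at most n - 1 - ∣A∣ do, and induction bounds the continuations of each. The full set is
-- excluded because every path ends there.
hits-≤ : ∀ d (A B : Subset n) → ∣ A ∣ + suc d ≡ n → ∣ B ∣ < n →
  ∑-paths (suc d) A (λ p → 𝟙 (B ∈ˢ? p)) ≤ d !
hits-≤ zero        A B eq B<n = ∑-paths-𝟙 1 A (B ∈ˢ?_) eq
hits-≤ {n} (suc d) A B eq B<n = begin
  ∑ (covers A) (λ A′ → ∑-paths (suc d) A′ (λ p → 𝟙 (B ∈ˢ? (A′ ∷ p))))
    ≤⟨ ∑-mono (covers A) through ⟩
  ∑ (covers A) (λ A′ → 𝟙 (A′ ⊆? B) * bound)
    ≡⟨ ∑-*ʳ (covers A) _ bound ⟩
  ∑ (covers A) (λ A′ → 𝟙 (A′ ⊆? B)) * bound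
    ≤⟨ *-monoˡ-≤ bound (∑-covers-⊆ A B) ⟩
  (∣ B ∣ ∸ ∣ A ∣) * bound
    ≤⟨ final ⟩
  suc d ! ∎
  where
  open ≤-Reasoning
  -- Bounds the continuations after a first step inside B: all of them if that step reaches B,
  -- otherwise the inductive bound.
  bound : ℕ
  bound with ∣ B ∣ ≟ suc ∣ A ∣
  ... | yes _ = suc d !
  ... | no  _ = d !

  through : ∀ {A′} → A′ ∈ covers A →
    ∑-paths (suc d) A′ (λ p → 𝟙 (B ∈ˢ? (A′ ∷ p))) ≤ 𝟙 (A′ ⊆? B) * bound
  through {A′} A′∈ with A′ ⊆? B
  ... | no A′⊈B = begin
    ∑-paths (suc d) A′ (λ p → 𝟙 (B ∈ˢ? (A′ ∷ p)))
      ≡⟨ ∑-paths-cong (suc d) A′ (λ p asc → 𝟙-no (B ∈ˢ? (A′ ∷ p)) λ where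
           (here refl) → A′⊈B ⊆-refl
           (there B∈p) → A′⊈B (proj₁ (ascends⇒⊂ asc B∈p))) ⟩
    ∑-paths (suc d) A′ (λ _ → 0) ≡⟨ ∑-paths-zero (suc d) A′ ⟩
    0 ∎
  ... | yes A′⊆B with ∣ B ∣ ≟ suc ∣ A ∣
  ...   | yes _ = ≤-trans (∑-paths-𝟙 (suc d) A′ (λ p → B ∈ˢ? (A′ ∷ p)) eq′) (≤-reflexive (sym (+-identityʳ _)))
    where
    eq′ : ∣ A′ ∣ + suc d ≡ n
    eq′ = trans (cong (_+ suc d) (∣cover∣ A A′∈)) (trans (sym (+-suc ∣ A ∣ (suc d))) eq)
  ...   | no B≢ = begin
    ∑-paths (suc d) A′ (λ p → 𝟙 (B ∈ˢ? (A′ ∷ p)))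
      ≤⟨ ∑-paths-mono (suc d) A′ (λ p _ → 𝟙-mono (B ∈ˢ? (A′ ∷ p)) (B ∈ˢ? p) λ where
           (here refl) → contradiction (∣cover∣ A A′∈) B≢
           (there B∈p) → B∈p) ⟩
    ∑-paths (suc d) A′ (λ p → 𝟙 (B ∈ˢ? p))
      ≤⟨ hits-≤ d A′ B (trans (cong (_+ suc d) (∣cover∣ A A′∈)) (trans (sym (+-suc ∣ A ∣ (suc d))) eq)) B<n ⟩
    d !       ≡⟨ +-identityʳ _ ⟨
    1 * d ! ∎

  final : (∣ B ∣ ∸ ∣ A ∣) * bound ≤ suc d !
  final with ∣ B ∣ ≟ suc ∣ A ∣
  ... | yes B≡ = begin
    (∣ B ∣ ∸ ∣ A ∣) * suc d !       ≡⟨ cong (λ b → (b ∸ ∣ A ∣) * suc d !) B≡ ⟩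
    (suc ∣ A ∣ ∸ ∣ A ∣) * suc d !   ≡⟨ cong (_* suc d !) (m+n∸n≡m 1 ∣ A ∣) ⟩
    1 * suc d !                     ≡⟨ +-identityʳ _ ⟩
    suc d ! ∎
  ... | no _ = *-monoˡ-≤ (d !) (begin
    ∣ B ∣ ∸ ∣ A ∣             ≤⟨ ∸-monoˡ-≤ ∣ A ∣ (s≤s⁻¹ (≤-trans B<n (≤-reflexive (trans (sym eq) (+-suc ∣ A ∣ (suc d)))))) ⟩
    ∣ A ∣ + suc d ∸ ∣ A ∣     ≡⟨ m+n∸m≡n ∣ A ∣ (suc d) ⟩
    suc d ∎)

-- Sizes of layers and binomial coefficients.

∈-layer⇒∣∣ : ∀ n k {A} → A ∈ layer n k → ∣ A ∣ ≡ k
∈-layer⇒∣∣ zero    zero    (here refl) = refl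
∈-layer⇒∣∣ (suc n) zero    A∈ with ∈-map⁻ _ A∈
... | _ , A′∈ , refl = ∈-layer⇒∣∣ n zero A′∈
∈-layer⇒∣∣ (suc n) (suc k) A∈ with ∈-++⁻ (map (inside ∷_) (layer n k)) A∈
... | inj₁ A∈ₗ with ∈-map⁻ _ A∈ₗ
...   | _ , A′∈ , refl = cong suc (∈-layer⇒∣∣ n k A′∈)
∈-layer⇒∣∣ (suc n) (suc k) A∈ | inj₂ A∈ᵣ with ∈-map⁻ _ A∈ᵣ
... | _ , A′∈ , refl = ∈-layer⇒∣∣ n (suc k) A′∈

∈-layer : ∀ (A : Subset n) → A ∈ layer n ∣ A ∣
∈-layer []            = here refl
∈-layer (inside  ∷ A) = ∈-++⁺ˡ (∈-map⁺ _ (∈-layer A))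
∈-layer {suc n} (outside ∷ A) = outside-case ∣ A ∣ (∈-layer A)
  where
  outside-case : ∀ k → A ∈ layer n k → (outside ∷ A) ∈ layer (suc n) k
  outside-case zero    A∈ = ∈-map⁺ _ A∈
  outside-case (suc k) A∈ = ∈-++⁺ʳ (map (inside ∷_) (layer n k)) (∈-map⁺ _ A∈)

nC0≡1 : ∀ n → n C 0 ≡ 1
nC0≡1 n = trans (nCk≡nC[n∸k] {0} {n} z≤n) (nCn≡1 n)

length-layer : ∀ n k → length (layer n k) ≡ n C k
length-layer zero    zero    = refl
length-layer zero    (suc k) = refl
length-layer (suc n) zero    = trans (length-map _ (layer n 0))
  (trans (length-layer n 0) (trans (nC0≡1 n) (sym (nC0≡1 (suc n)))))
length-layer (suc n) (suc k) = trans (length-++ (map (inside ∷_) (layer n k)))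
  (trans (cong₂ _+_ (trans (length-map _ (layer n k)) (length-layer n k))
                    (trans (length-map _ (layer n (suc k))) (length-layer n (suc k))))
         (nCk+nC[k+1]≡[n+1]C[k+1] n k))

-- Both sides count the cover pairs between layers k and k + 1.
absorption : ∀ n k → suc k * (n C suc k) ≡ (n ∸ k) * (n C k)
absorption n k = begin
  suc k * (n C suc k)                             ≡⟨ cong (suc k *_) (length≡∑1 (suc k)) ⟩
  suc k * ∑ (layer n (suc k)) (λ _ → 1)           ≡⟨ ∑-covers-layer n k (λ _ → 1) ⟨
  ∑ (layer n k) (λ A → ∑ (covers A) (λ _ → 1))    ≡⟨ ∑-cong (layer n k) (λ {A} A∈ → trans (∑-const (covers A) 1) (cong (_* 1) (∣covers∣ A∈))) ⟩
  ∑ (layer n k) (λ _ → (n ∸ k) * 1)               ≡⟨ ∑-const (layer n k) _ ⟩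
  length (layer n k) * ((n ∸ k) * 1)              ≡⟨ cong₂ _*_ (length-layer n k) (*-identityʳ (n ∸ k)) ⟩
  (n C k) * (n ∸ k)                               ≡⟨ *-comm (n C k) (n ∸ k) ⟩
  (n ∸ k) * (n C k) ∎
  where
  open ≡-Reasoning
  length≡∑1 : ∀ k → n C k ≡ ∑ (layer n k) (λ _ → 1)
  length≡∑1 k = trans (sym (length-layer n k)) (sym (trans (∑-const (layer n k) 1) (*-identityʳ _)))

  ∣covers∣ : ∀ {A} → A ∈ layer n k → length (covers A) ≡ n ∸ k
  ∣covers∣ {A} A∈ = trans (sym (m+n∸m≡n ∣ A ∣ _)) (cong₂ _∸_ (∣A∣+∣covers∣ A) (∈-layer⇒∣∣ n k A∈))

-- Below the middle k + 1 ≤ n - k, so `absorption` shows that each step from k to k + 1 does not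
-- decrease the coefficient.
C-mono-below-middle : ∀ n j i → i + j ≤ ⌊ n /2⌋ → n C j ≤ n C (i + j)
C-mono-below-middle n j zero    _   = ≤-refl
C-mono-below-middle n j (suc i) i+j< = ≤-trans (C-mono-below-middle n j i (<⇒≤ i+j<))
  (*-cancelˡ-≤ (suc k) (begin
    suc k * (n C k)      ≤⟨ *-monoˡ-≤ (n C k) k< ⟩
    (n ∸ k) * (n C k)    ≡⟨ absorption n k ⟨
    suc k * (n C suc k)  ∎))
  where
  open ≤-Reasoning
  k : ℕ
  k = i + j
  k< : suc k ≤ n ∸ k
  k< = begin
    suc k                         ≤⟨ i+j< ⟩
    ⌊ n /2⌋                       ≤⟨ ⌊n/2⌋≤⌈n/2⌉ n ⟩
    ⌈ n /2⌉                       ≡⟨ m+n∸m≡n ⌊ n /2⌋ ⌈ n /2⌉ ⟨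
    ⌊ n /2⌋ + ⌈ n /2⌉ ∸ ⌊ n /2⌋   ≡⟨ cong (_∸ ⌊ n /2⌋) (⌊n/2⌋+⌈n/2⌉≡n n) ⟩
    n ∸ ⌊ n /2⌋                   ≤⟨ ∸-monoʳ-≤ n (<⇒≤ i+j<) ⟩
    n ∸ k                         ∎

C-≤-middle : ∀ n k → n C k ≤ n C ⌊ n /2⌋
C-≤-middle n k with k ≤? ⌊ n /2⌋
... | yes k≤ = ≤-trans (C-mono-below-middle n k (⌊ n /2⌋ ∸ k) (≤-reflexive (m∸n+n≡m k≤)))
  (≤-reflexive (cong (n C_) (m∸n+n≡m k≤)))
... | no  k≰ with k ≤? n
...   | no  k≰n = ≤-trans (≤-reflexive (k>n⇒nCk≡0 (≰⇒> k≰n))) z≤n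
...   | yes k≤n = ≤-trans (≤-reflexive (nCk≡nC[n∸k] k≤n))
  (≤-trans (C-mono-below-middle n k′ (⌊ n /2⌋ ∸ k′) (≤-reflexive (m∸n+n≡m k′≤)))
           (≤-reflexive (cong (n C_) (m∸n+n≡m k′≤))))
  where
  open ≤-Reasoning
  k′ : ℕ
  k′ = n ∸ k
  k′≤ : k′ ≤ ⌊ n /2⌋
  k′≤ = begin
    n ∸ k                           ≤⟨ ∸-monoʳ-≤ n (≰⇒> k≰) ⟩
    n ∸ suc ⌊ n /2⌋                 ≡⟨ cong (_∸ suc ⌊ n /2⌋) (⌊n/2⌋+⌈n/2⌉≡n n) ⟨
    ⌊ n /2⌋ + ⌈ n /2⌉ ∸ suc ⌊ n /2⌋ ≤⟨ ∸-monoˡ-≤ (suc ⌊ n /2⌋) (+-monoʳ-≤ ⌊ n /2⌋ (⌊n/2⌋-mono (n≤1+n (suc n)))) ⟩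
    ⌊ n /2⌋ + suc ⌊ n /2⌋ ∸ suc ⌊ n /2⌋ ≡⟨ m+n∸n≡m ⌊ n /2⌋ (suc ⌊ n /2⌋) ⟩
    ⌊ n /2⌋ ∎

C*k!*[n∸k]!≡n! : ∀ {n k} → k ≤ n → (n C k) * (k ! * (n ∸ k) !) ≡ n !
C*k!*[n∸k]!≡n! {n} {k} k≤n = trans (cong (_* (k ! * (n ∸ k) !)) (nCk≡n!/k![n-k]! k≤n))
  (m/n*n≡m (k![n∸k]!∣n! k≤n))
  where instance _ = k !* (n ∸ k) !≢0

-- Blocked chains and a Lubell-type inequality.

Blocks : Pred (Subset n) 0ℓ → ℕ → List (Subset n) → Subset n → Set
Blocks {n} Q h S A = ∀ (Bs : Vec (Subset n) h) → Ascends A (toList Bs) → All Q (toList Bs) →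
  ∃[ B ] B ∈ toList Bs × B ∈ S

module _ {Q : Pred (Subset n) 0ℓ} (Q? : Decidable Q) where

  count : List (Subset n) → ℕ
  count p = ∑ p (𝟙 ∘ Q?)

  -- The first h members of `Q` along the path are kept; transitivity of `⊂` bridges the sets that
  -- are dropped.
  subchain : ∀ h {A p} → Ascends A p → h ≤ count p →
    ∃[ Bs ] Ascends A (toList {n = h} Bs) × All Q (toList Bs) × All (_∈ p) (toList Bs)
  subchain zero    asc h≤ = [] , [-] , [] , []
  subchain (suc h) {A} {B ∷ p} (A⊂B ∷ asc) h≤ with Q? B
  ... | yes q with subchain h asc (s≤s⁻¹ h≤)
  ...   | Bs , asc′ , qs , ∈p = (B ∷ Bs) , A⊂B ∷ asc′ , q ∷ qs , here refl ∷ All.map there ∈p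
  subchain (suc h) {A} {B ∷ p} (A⊂B ∷ asc) h≤ | no _ with subchain (suc h) asc h≤
  ... | Bs , asc′ , qs , ∈p = Bs , ascends-shorten A⊂B asc′ , qs , All.map there ∈p

  -- Union bound: a path with at least h members of `Q` contains an h-chain of `Q` above A, hence
  -- meets S, and `hits-≤` bounds the paths through each member of S.
  bad-paths-≤ : ∀ h {A S} d → ∣ A ∣ + suc d ≡ n → Blocks Q h S A → All (λ B → ∣ B ∣ < n) S →
    ∑-paths (suc d) A (λ p → 𝟙 (h ≤? count p)) ≤ length S * d !
  bad-paths-≤ h {A} {S} d eq blk S<n = begin
    ∑-paths (suc d) A (λ p → 𝟙 (h ≤? count p))
      ≤⟨ ∑-paths-mono (suc d) A blocked ⟩
    ∑-paths (suc d) A (λ p → ∑ S (λ B → 𝟙 (B ∈ˢ? p)))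
      ≡⟨ ∑-paths-∑ (suc d) A S (λ B p → 𝟙 (B ∈ˢ? p)) ⟩
    ∑ S (λ B → ∑-paths (suc d) A (λ p → 𝟙 (B ∈ˢ? p)))
      ≤⟨ ∑-mono S (λ {B} B∈ → hits-≤ d A B eq (All.lookup S<n B∈)) ⟩
    ∑ S (λ _ → d !)
      ≡⟨ ∑-const S (d !) ⟩
    length S * d ! ∎
    where
    open ≤-Reasoning
    ∑-𝟙-≥1 : ∀ {S B p} → B ∈ S → B ∈ p → 1 ≤ ∑ S (λ B → 𝟙 (B ∈ˢ? p))
    ∑-𝟙-≥1 {p = p} (here {x = B} refl) B∈p rewrite 𝟙-yes (B ∈ˢ? p) B∈p = s≤s z≤n
    ∑-𝟙-≥1 {p = p} (there {x = C} B∈S) B∈p = m≤n⇒m≤o+n (𝟙 (C ∈ˢ? p)) (∑-𝟙-≥1 B∈S B∈p)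

    blocked : ∀ p → Ascends A p → 𝟙 (h ≤? count p) ≤ ∑ S (λ B → 𝟙 (B ∈ˢ? p))
    blocked p asc with h ≤? count p
    ... | no _ = z≤n
    ... | yes h≤ with subchain h asc h≤
    ...   | Bs , asc′ , qs , ∈p with blk Bs asc′ qs
    ...     | B , B∈Bs , B∈S = ∑-𝟙-≥1 B∈S (All.lookup ∈p B∈Bs)

  module _ (h c t : ℕ) (m>0 : 0 < c + t)
    (Q-low : ∀ {A} → Q A → ∣ A ∣ + (c + t) ≤ n)
    (blockers : ∀ {A} → Q A → ∃[ S ] length S ≤ c × All Q S × Blocks Q h S A)
    where

    Q⇒<n : ∀ {A} → Q A → ∣ A ∣ < n
    Q⇒<n {A} q = ≤-trans (≤-trans (≤-reflexive (+-comm 1 ∣ A ∣)) (+-monoʳ-≤ ∣ A ∣ m>0)) (Q-low q)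

    good : ℕ → Subset n → ℕ
    good d A = ∑-paths d A (λ p → 𝟙 (count p <? h))

    -- At most c (d - 1) ! of the d ! paths are bad, a share of c / d. Since A misses d ≥ c + t
    -- elements, the good share is at least t / (c + t); the inequality is stated with this
    -- denominator cleared.
    good-≥ : ∀ d {A} → Q A → ∣ A ∣ + d ≡ n → t * d ! ≤ (c + t) * good d A
    good-≥ zero {A} q eq = contradiction (trans (sym (+-identityʳ ∣ A ∣)) eq) (<⇒≢ (Q⇒<n q))
    good-≥ (suc d) {A} q eq with blockers q
    ... | S , S≤c , S-Q , blk = +-cancelʳ-≤ (c * suc d !) _ _ (begin
      t * suc d ! + c * suc d !
        ≡⟨ solve 3 (λ t c f → t :* f :+ c :* f := (c :+ t) :* f) refl t c (suc d !) ⟩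
      (c + t) * suc d !
        ≡⟨ cong ((c + t) *_) (*-identityʳ (suc d !)) ⟨
      (c + t) * (suc d ! * 1)
        ≡⟨ cong ((c + t) *_) (∑-paths-const (suc d) A 1 eq) ⟨
      (c + t) * ∑-paths (suc d) A (λ _ → 1)
        ≡⟨ cong ((c + t) *_) (∑-paths-cong (suc d) A (λ p _ → good+bad p)) ⟩
      (c + t) * ∑-paths (suc d) A (λ p → 𝟙 (count p <? h) + 𝟙 (h ≤? count p))
        ≡⟨ cong ((c + t) *_) (∑-paths-+ (suc d) A (λ p → 𝟙 (count p <? h)) (λ p → 𝟙 (h ≤? count p))) ⟩
      (c + t) * (good (suc d) A + ∑-paths (suc d) A (λ p → 𝟙 (h ≤? count p)))
        ≤⟨ *-monoʳ-≤ (c + t) (+-monoʳ-≤ (good (suc d) A) (≤-trans (bad-paths-≤ h d eq blk (All.map Q⇒<n S-Q)) (*-monoˡ-≤ (d !) S≤c))) ⟩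
      (c + t) * (good (suc d) A + c * d !)
        ≡⟨ solve 4 (λ m g c f → m :* (g :+ c :* f) := m :* g :+ c :* (m :* f)) refl (c + t) (good (suc d) A) c (d !) ⟩
      (c + t) * good (suc d) A + c * ((c + t) * d !)
        ≤⟨ +-monoʳ-≤ ((c + t) * good (suc d) A) (*-monoʳ-≤ c (*-monoˡ-≤ (d !) m≤d)) ⟩
      (c + t) * good (suc d) A + c * suc d ! ∎)
      where
      open ≤-Reasoning
      open +-*-Solver
      m≤d : c + t ≤ suc d
      m≤d = +-cancelˡ-≤ ∣ A ∣ _ _ (≤-trans (Q-low q) (≤-reflexive (sym eq)))

      good+bad : ∀ p → 1 ≡ 𝟙 (count p <? h) + 𝟙 (h ≤? count p)
      good+bad p with count p <? h
      ... | yes <h = cong suc (sym (𝟙-no (h ≤? count p) (<⇒≱ <h)))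
      ... | no  ≮h = sym (𝟙-yes (h ≤? count p) (≮⇒≥ ≮h))

    -- min(h, count) over a path from A grows by 1 at A ∈ Q exactly on the good paths.
    Φ : ℕ → ℕ
    Φ k = ∑ (layer n k) (λ A → ∑-paths (n ∸ k) A (λ p → h ⊓ count (A ∷ p)))

    -- Removing the start A from the count separates the good paths. The remaining sum over paths
    -- from A is regrouped by their first step, and `∑-covers-layer` supplies the factor k + 1.
    Φ-step : ∀ k → k < n →
      Φ k ≡ ∑ (layer n k) (λ A → 𝟙 (Q? A) * good (n ∸ k) A) + suc k * Φ (suc k)
    Φ-step k k<n = begin
      Φ k
        ≡⟨ ∑-cong (layer n k) (λ {A} _ → trans (∑-paths-cong (n ∸ k) A (λ p _ → peel A p)) (∑-paths-+ (n ∸ k) A (λ p → 𝟙 (Q? A) * 𝟙 (count p <? h)) (λ p → h ⊓ count p))) ⟩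
      ∑ (layer n k) (λ A → ∑-paths (n ∸ k) A (λ p → 𝟙 (Q? A) * 𝟙 (count p <? h)) + ∑-paths (n ∸ k) A (λ p → h ⊓ count p))
        ≡⟨ ∑-+ (layer n k) _ _ ⟩
      ∑ (layer n k) (λ A → ∑-paths (n ∸ k) A (λ p → 𝟙 (Q? A) * 𝟙 (count p <? h))) + ∑ (layer n k) (λ A → ∑-paths (n ∸ k) A (λ p → h ⊓ count p))
        ≡⟨ cong₂ _+_ (∑-cong (layer n k) (λ {A} _ → pull A)) (trans (cong (λ d → ∑ (layer n k) (λ A → ∑-paths d A (λ p → h ⊓ count p))) n∸k≡) (∑-covers-layer n k _)) ⟩
      ∑ (layer n k) (λ A → 𝟙 (Q? A) * good (n ∸ k) A) + suc k * Φ (suc k) ∎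
      where
      open ≡-Reasoning
      n∸k≡ : n ∸ k ≡ suc (n ∸ suc k)
      n∸k≡ = +-∸-assoc 1 k<n

      peel : ∀ A p → h ⊓ count (A ∷ p) ≡ 𝟙 (Q? A) * 𝟙 (count p <? h) + h ⊓ count p
      peel A p with Q? A
      ... | no _ = refl
      ... | yes _ with count p <? h
      ...   | yes <h = trans (m≥n⇒m⊓n≡n <h) (cong suc (sym (m≥n⇒m⊓n≡n (<⇒≤ <h))))
      ...   | no  ≮h = trans (m≤n⇒m⊓n≡m (m≤n⇒m≤1+n (≮⇒≥ ≮h))) (sym (m≤n⇒m⊓n≡m (≮⇒≥ ≮h)))

      pull : ∀ A → ∑-paths (n ∸ k) A (λ p → 𝟙 (Q? A) * 𝟙 (count p <? h)) ≡ 𝟙 (Q? A) * good (n ∸ k) A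
      pull A with Q? A
      ... | no  _ = ∑-paths-zero (n ∸ k) A
      ... | yes _ = trans (∑-paths-cong (n ∸ k) A (λ p _ → +-identityʳ _)) (sym (+-identityʳ _))

    #layer : ℕ → ℕ
    #layer k = ∑ (layer n k) (𝟙 ∘ Q?)

    layer-≤ : ∀ k → k < n → #layer k * (t * (n ∸ k) !) + (c + t) * (suc k * Φ (suc k)) ≤ (c + t) * Φ k
    layer-≤ k k<n = begin
      #layer k * (t * (n ∸ k) !) + (c + t) * (suc k * Φ (suc k))
        ≡⟨ cong (_+ (c + t) * (suc k * Φ (suc k))) (∑-*ʳ (layer n k) _ _) ⟨
      ∑ (layer n k) (λ A → 𝟙 (Q? A) * (t * (n ∸ k) !)) + (c + t) * (suc k * Φ (suc k))
        ≤⟨ +-monoˡ-≤ _ (∑-mono (layer n k) each) ⟩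
      ∑ (layer n k) (λ A → 𝟙 (Q? A) * good (n ∸ k) A * (c + t)) + (c + t) * (suc k * Φ (suc k))
        ≡⟨ cong (_+ (c + t) * (suc k * Φ (suc k))) (trans (∑-*ʳ (layer n k) _ (c + t)) (*-comm _ (c + t))) ⟩
      (c + t) * ∑ (layer n k) (λ A → 𝟙 (Q? A) * good (n ∸ k) A) + (c + t) * (suc k * Φ (suc k))
        ≡⟨ *-distribˡ-+ (c + t) _ _ ⟨
      (c + t) * (∑ (layer n k) (λ A → 𝟙 (Q? A) * good (n ∸ k) A) + suc k * Φ (suc k))
        ≡⟨ cong ((c + t) *_) (Φ-step k k<n) ⟨
      (c + t) * Φ k ∎
      where
      open ≤-Reasoning
      each : ∀ {A} → A ∈ layer n k → 𝟙 (Q? A) * (t * (n ∸ k) !) ≤ 𝟙 (Q? A) * good (n ∸ k) A * (c + t)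
      each {A} A∈ with Q? A
      ... | no  _ = z≤n
      ... | yes q = begin
        1 * (t * (n ∸ k) !)            ≡⟨ +-identityʳ _ ⟩
        t * (n ∸ k) !                  ≤⟨ good-≥ (n ∸ k) q (trans (cong (_+ (n ∸ k)) (∈-layer⇒∣∣ n k A∈)) (m+[n∸m]≡n (<⇒≤ k<n))) ⟩
        (c + t) * good (n ∸ k) A       ≡⟨ *-comm (c + t) _ ⟩
        good (n ∸ k) A * (c + t)       ≡⟨ cong (_* (c + t)) (+-identityʳ (good (n ∸ k) A)) ⟨
        1 * good (n ∸ k) A * (c + t)   ∎

    private
      N : ℕ
      N = n C ⌊ n /2⌋

    -- The inequality `layer-≤` for layer k is weighted by N k !. Then k ! (k + 1) = (k + 1) ! makes
    -- the terms in `Φ` telescope, and N k ! (n - k) ! ≥ n ! because N is the largest binomial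
    -- coefficient.
    telescope : ∀ K → K ≤ n →
      ∑ (downFrom K) #layer * (t * n !) + (c + t) * (N * (K ! * Φ K)) ≤ (c + t) * (N * Φ 0)
    telescope zero    _   = ≤-reflexive (cong (λ x → (c + t) * (N * x)) (+-identityʳ (Φ 0)))
    telescope (suc K) K<n = begin
      (#layer K + s) * (t * n !) + (c + t) * (N * (suc K ! * Φ (suc K)))
        ≤⟨ +-monoˡ-≤ _ (begin
            (#layer K + s) * (t * n !)            ≡⟨ solve 4 (λ a s t f → (a :+ s) :* (t :* f) := s :* (t :* f) :+ a :* t :* f) refl (#layer K) s t (n !) ⟩
            s * (t * n !) + #layer K * t * n !    ≤⟨ +-monoʳ-≤ (s * (t * n !)) (*-monoʳ-≤ (#layer K * t) n!≤) ⟩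
            s * (t * n !) + #layer K * t * (N * (K ! * (n ∸ K) !)) ∎) ⟩
      s * (t * n !) + #layer K * t * (N * (K ! * (n ∸ K) !)) + (c + t) * (N * (suc K ! * Φ (suc K)))
        ≡⟨ solve 9 (λ x a t N k! d! m sk Φ′ → x :+ a :* t :* (N :* (k! :* d!)) :+ m :* (N :* ((sk :* k!) :* Φ′))
             := x :+ N :* k! :* (a :* (t :* d!) :+ m :* (sk :* Φ′))) refl
             (s * (t * n !)) (#layer K) t N (K !) ((n ∸ K) !) (c + t) (suc K) (Φ (suc K)) ⟩
      s * (t * n !) + N * K ! * (#layer K * (t * (n ∸ K) !) + (c + t) * (suc K * Φ (suc K)))
        ≤⟨ +-monoʳ-≤ (s * (t * n !)) (*-monoʳ-≤ (N * K !) (layer-≤ K K<n)) ⟩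
      s * (t * n !) + N * K ! * ((c + t) * Φ K)
        ≡⟨ cong (s * (t * n !) +_) (solve 4 (λ N k! m Φ → N :* k! :* (m :* Φ) := m :* (N :* (k! :* Φ))) refl N (K !) (c + t) (Φ K)) ⟩
      s * (t * n !) + (c + t) * (N * (K ! * Φ K))
        ≤⟨ telescope K (<⇒≤ K<n) ⟩
      (c + t) * (N * Φ 0) ∎
      where
      open ≤-Reasoning
      open +-*-Solver
      s : ℕ
      s = ∑ (downFrom K) #layer
      n!≤ : n ! ≤ N * (K ! * (n ∸ K) !)
      n!≤ = ≤-trans (≤-reflexive (sym (C*k!*[n∸k]!≡n! (<⇒≤ K<n)))) (*-monoˡ-≤ (K ! * (n ∸ K) !) (C-≤-middle n K))

    Φ0≤ : Φ 0 ≤ h * n !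
    Φ0≤ = begin
      Φ 0
        ≤⟨ ∑-mono (layer n 0) (λ {A} A∈ → ≤-trans (∑-paths-mono n A (λ p _ → m⊓n≤m h (count (A ∷ p))))
             (≤-reflexive (∑-paths-const n A h (cong (_+ n) (∈-layer⇒∣∣ n 0 A∈))))) ⟩
      ∑ (layer n 0) (λ _ → n ! * h)  ≡⟨ ∑-const (layer n 0) _ ⟩
      length (layer n 0) * (n ! * h) ≡⟨ cong (_* (n ! * h)) (trans (length-layer n 0) (nC0≡1 n)) ⟩
      1 * (n ! * h)                  ≡⟨ trans (+-identityʳ _) (*-comm (n !) h) ⟩
      h * n ! ∎
      where open ≤-Reasoning

    -- `telescope` at K = n with n ! cancelled. Layer n is absent from the sum because the full set
    -- is not in `Q`, so the sum counts all of `Q`.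
    lubell-≤ : t * ∑ (downFrom n) #layer ≤ (c + t) * (h * N)
    lubell-≤ = *-cancelʳ-≤ _ _ (n !) (begin
      t * s * n !                                       ≡⟨ trans (cong (_* n !) (*-comm t s)) (*-assoc s t (n !)) ⟩
      s * (t * n !)                                     ≤⟨ m≤m+n _ _ ⟩
      s * (t * n !) + (c + t) * (N * (n ! * Φ n))       ≤⟨ telescope n ≤-refl ⟩
      (c + t) * (N * Φ 0)                               ≤⟨ *-monoʳ-≤ (c + t) (*-monoʳ-≤ N Φ0≤) ⟩
      (c + t) * (N * (h * n !))                         ≡⟨ solve 4 (λ m N h f → m :* (N :* (h :* f)) := m :* (h :* N) :* f) refl (c + t) N h (n !) ⟩
      (c + t) * (h * N) * n !                           ∎)
      where
      open ≤-Reasoning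
      open +-*-Solver
      instance _ = n !≢0
      s : ℕ
      s = ∑ (downFrom n) #layer

-- Disjoint chains above a set, or a small blocking set.

module _ {R : Pred (Subset n) 0ℓ} (R? : Decidable R) where

  climb? : ∀ h A → Dec (∃[ Bs ] Ascends A (toList {n = h} Bs) × All R (toList Bs))
  climb? zero    A = yes ([] , [-] , [])
  climb? (suc h) A = map′
    (λ where (B , A⊂B , r , Bs , asc , rs) → B ∷ Bs , A⊂B ∷ asc , r ∷ rs)
    (λ where (B ∷ Bs , A⊂B ∷ asc , r ∷ rs) → B , A⊂B , r , Bs , asc , rs)
    (anySubset? (λ B → A ⊂? B ×-dec R? B ×-dec climb? h B))

-- The last index collects all sets used so far, so pairwise disjointness of the r chains reduces to
-- one condition for each new chain.
data Petals (Q : Pred (Subset n) 0ℓ) (h : ℕ) (A : Subset n) : ℕ → List (Subset n) → Set where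
  []   : Petals Q h A 0 []
  grow : ∀ {r S} (Bs : Vec (Subset n) h) → Ascends A (toList Bs) → All Q (toList Bs) →
         All (_∉ S) (toList Bs) → Petals Q h A r S → Petals Q h A (suc r) (toList Bs ++ S)

module _ {Q : Pred (Subset n) 0ℓ} {h : ℕ} {A : Subset n} where

  length-petals : ∀ {r S} → Petals Q h A r S → length S ≡ r * h
  length-petals [] = refl
  length-petals (grow {S = S} Bs _ _ _ P) = trans (length-++ (toList Bs))
    (cong₂ _+_ (Vec.length-toList Bs) (length-petals P))

  petals-Q : ∀ {r S} → Petals Q h A r S → All Q S
  petals-Q []                  = []
  petals-Q (grow Bs _ qs _ P) = ++⁺ qs (petals-Q P)

  -- Greedy choice: chains avoiding the used sets S are added one at a time. When no further one
  -- exists, every h-chain of `Q` above A meets S, so S itself is the blocker.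
  petals-or-blocker : (Q? : Decidable Q) → ∀ r →
    (∃[ S ] Petals Q h A r S) ⊎ (∃[ S ] length S ≤ r * h × All Q S × Blocks Q h S A)
  petals-or-blocker Q? zero    = inj₁ ([] , [])
  petals-or-blocker Q? (suc r) with petals-or-blocker Q? r
  ... | inj₂ (S , S≤ , qs , blk) = inj₂ (S , m≤n⇒m≤o+n h S≤ , qs , blk)
  ... | inj₁ (S , P) with climb? (λ B → Q? B ×-dec ¬? (B ∈ˢ? S)) h A
  ...   | yes (Bs , asc , rs) = inj₁ (_ , grow Bs asc (All.map proj₁ rs) (All.map proj₂ rs) P)
  ...   | no ∄ = inj₂ (S , m≤n⇒m≤o+n h (≤-reflexive (length-petals P)) , petals-Q P , blk)
    where
    blk : Blocks Q h S A
    blk Bs asc qs with any? (_∈ˢ? S) (toList Bs)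
    ... | yes hit = find hit
    ... | no  ¬hit = contradiction (Bs , asc , All.zip (qs , ¬Any⇒All¬ _ ¬hit)) ∄

  petal : ∀ {r S} → Petals Q h A r S → Fin r → Vec (Subset n) h
  petal (grow Bs _ _ _ P) Fin.zero    = Bs
  petal (grow Bs _ _ _ P) (Fin.suc i) = petal P i

  petal-ascends : ∀ {r S} (P : Petals Q h A r S) i → Ascends A (toList (petal P i))
  petal-ascends (grow Bs asc _ _ P) Fin.zero    = asc
  petal-ascends (grow Bs asc _ _ P) (Fin.suc i) = petal-ascends P i

  ∈-petal : ∀ {r S} (P : Petals Q h A r S) i {B} → B ∈ toList (petal P i) → B ∈ S
  ∈-petal (grow Bs _ _ _ P) Fin.zero    B∈ = ∈-++⁺ˡ B∈
  ∈-petal (grow Bs _ _ _ P) (Fin.suc i) B∈ = ∈-++⁺ʳ (toList Bs) (∈-petal P i B∈)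

  petals-disjoint : ∀ {r S} (P : Petals Q h A r S) i j {B} →
    B ∈ toList (petal P i) → B ∈ toList (petal P j) → i ≡ j
  petals-disjoint (grow Bs _ _ new P) Fin.zero    Fin.zero    _   _   = refl
  petals-disjoint (grow Bs _ _ new P) Fin.zero    (Fin.suc j) B∈i B∈j =
    contradiction (∈-petal P j B∈j) (All.lookup new B∈i)
  petals-disjoint (grow Bs _ _ new P) (Fin.suc i) Fin.zero    B∈i B∈j =
    contradiction (∈-petal P i B∈i) (All.lookup new B∈j)
  petals-disjoint (grow Bs _ _ new P) (Fin.suc i) (Fin.suc j) B∈i B∈j =
    cong Fin.suc (petals-disjoint P i j B∈i B∈j)

-- Embedding a fan into a family.

∈-lookup : ∀ {h} (Bs : Vec (Subset n) h) a → lookup Bs a ∈ toList Bs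
∈-lookup (B ∷ Bs) Fin.zero    = here refl
∈-lookup (B ∷ Bs) (Fin.suc a) = there (∈-lookup Bs a)

lookup-⊂ : ∀ {h A} (Bs : Vec (Subset n) h) → Ascends A (toList Bs) →
  ∀ {a b} → a Fin.< b → lookup Bs a ⊂ lookup Bs b
lookup-⊂ (B ∷ Bs) (_ ∷ asc) {Fin.zero}  {Fin.suc b} _         = ascends⇒⊂ asc (∈-lookup Bs b)
lookup-⊂ (B ∷ Bs) (_ ∷ asc) {Fin.suc a} {Fin.suc b} (s≤s a<b) = lookup-⊂ Bs asc a<b

lookup-⊆ : ∀ {h A} (Bs : Vec (Subset n) h) → Ascends A (toList Bs) →
  ∀ {a b} → a Fin.≤ b → lookup Bs a ⊆ lookup Bs b
lookup-⊆ Bs asc {a} {b} a≤b with Fin.<-cmp a b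
... | tri< a<b _ _    = proj₁ (lookup-⊂ Bs asc a<b)
... | tri≈ _ refl _   = ⊆-refl
... | tri> _ _ b<a    = contradiction a≤b (<⇒≱ b<a)

lookup-injective : ∀ {h A} (Bs : Vec (Subset n) h) → Ascends A (toList Bs) →
  ∀ {a b} → lookup Bs a ≡ lookup Bs b → a ≡ b
lookup-injective Bs asc {a} {b} eq with Fin.<-cmp a b
... | tri< a<b _ _ = contradiction (lookup-⊂ Bs asc a<b) (⊂-irref eq)
... | tri≈ _ a≡b _ = a≡b
... | tri> _ _ b<a = contradiction (lookup-⊂ Bs asc b<a) (⊂-irref (sym eq))

module _ {k : ℕ} {ℓ : Fin k → ℕ} {𝓕 : Pred (Subset n) 0ℓ} where

  fan-⊑ : (f : Fan ℓ → Subset n) → (∀ x → 𝓕 (f x)) →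
    (∀ {x y} → x ≤ᶠ y → f x ⊆ f y) → (∀ {x y} → f x ≡ f y → x ≡ y) →
    fan ℓ ⊑ FamilyPoset 𝓕
  fan-⊑ f f∈ mono inj = record
    { ⟦_⟧ = λ x → f x , f∈ x
    ; isOrderHomomorphism = record { cong = cong f ; mono = mono }
    } , inj

  -- The root goes to A and the i-th chain to an initial segment of the i-th petal. Injectivity
  -- holds across petals by disjointness and within a petal by strict ascent.
  petals⇒⊑ : ∀ {Q : Pred (Subset n) 0ℓ} {h A S} → Petals Q h A k S →
    (∀ {B} → Q B → 𝓕 B) → 𝓕 A → (∀ i → ℓ i ∸ 1 ≤ h) → fan ℓ ⊑ FamilyPoset 𝓕
  petals⇒⊑ {h = h} {A} P Q⊆𝓕 A∈𝓕 ℓ≤ = fan-⊑ f f∈ mono inj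
    where
    place : ∀ i → Fin (ℓ i ∸ 1) → Fin h
    place i a = Fin.inject≤ a (ℓ≤ i)

    f : Fan ℓ → Subset n
    f root       = A
    f (node i a) = lookup (petal P i) (place i a)

    f-petal : ∀ i a → f (node i a) ∈ toList (petal P i)
    f-petal i a = ∈-lookup (petal P i) (place i a)

    root⊂ : ∀ i a → A ⊂ f (node i a)
    root⊂ i a = ascends⇒⊂ (petal-ascends P i) (f-petal i a)

    f∈ : ∀ x → 𝓕 (f x)
    f∈ root       = A∈𝓕
    f∈ (node i a) = Q⊆𝓕 (All.lookup (petals-Q P) (∈-petal P i (f-petal i a)))

    mono : ∀ {x y} → x ≤ᶠ y → f x ⊆ f y
    mono (root≤ {root})     = ⊆-refl
    mono (root≤ {node i a}) = proj₁ (root⊂ i a)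
    mono (node≤ {i} {a} {b} a≤b) = lookup-⊆ (petal P i) (petal-ascends P i)
      (subst₂ _≤_ (sym (Fin.toℕ-inject≤ a (ℓ≤ i))) (sym (Fin.toℕ-inject≤ b (ℓ≤ i))) a≤b)

    inj : ∀ {x y} → f x ≡ f y → x ≡ y
    inj {root}     {root}     _  = refl
    inj {root}     {node i a} eq = contradiction (root⊂ i a) (⊂-irref eq)
    inj {node i a} {root}     eq = contradiction (root⊂ i a) (⊂-irref (sym eq))
    inj {node i a} {node j b} eq
      with petals-disjoint P i j (f-petal i a) (subst (_∈ toList (petal P j)) (sym eq) (f-petal j b))
    ... | refl = cong (node i) (Fin.inject≤-injective (ℓ≤ i) (ℓ≤ i) a b
                   (lookup-injective (petal P i) (petal-ascends P i) eq))

  free-antitone : ∀ {𝓖 : Pred (Subset n) 0ℓ} → (∀ {A} → 𝓖 A → 𝓕 A) → fan ℓ -free 𝓕 → fan ℓ -free 𝓖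
  free-antitone 𝓖⊆𝓕 free (f , inj) = free (fan-⊑ (proj₁ ∘ ⟦_⟧) (𝓖⊆𝓕 ∘ proj₂ ∘ ⟦_⟧) mono inj)
    where open PosetHomomorphism f using (⟦_⟧; mono)

-- The value of e for fans.

⊆∧≢⇒∣∣< : ∀ {A B : Subset n} → A ⊆ B → A ≢ B → ∣ A ∣ < ∣ B ∣
⊆∧≢⇒∣∣< {A = []}          {[]}          A⊆B A≢B = contradiction refl A≢B
⊆∧≢⇒∣∣< {A = inside ∷ A}  {inside ∷ B}  A⊆B A≢B = s≤s (⊆∧≢⇒∣∣< (drop-∷-⊆ A⊆B) (A≢B ∘ cong (inside ∷_)))
⊆∧≢⇒∣∣< {A = inside ∷ A}  {outside ∷ B} A⊆B A≢B with A⊆B here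
... | ()
⊆∧≢⇒∣∣< {A = outside ∷ A} {inside ∷ B}  A⊆B A≢B = s≤s (p⊆q⇒∣p∣≤∣q∣ (drop-∷-⊆ A⊆B))
⊆∧≢⇒∣∣< {A = outside ∷ A} {outside ∷ B} A⊆B A≢B = ⊆∧≢⇒∣∣< (drop-∷-⊆ A⊆B) (A≢B ∘ cong (outside ∷_))

increasing-≥ : ∀ {h} x (s : Fin h → ℕ) → (∀ a → x < s a) → (∀ {a b} → a Fin.< b → s a < s b) →
  ∀ a → x + suc (toℕ a) ≤ s a
increasing-≥ x s x< mono Fin.zero    = ≤-trans (≤-reflexive (+-comm x 1)) (x< Fin.zero)
increasing-≥ x s x< mono (Fin.suc a) = begin
  x + suc (suc (toℕ a))            ≡⟨ +-suc x (suc (toℕ a)) ⟩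
  suc x + suc (toℕ a)              ≤⟨ +-monoˡ-≤ (suc (toℕ a)) (x< Fin.zero) ⟩
  s Fin.zero + suc (toℕ a)         ≤⟨ increasing-≥ (s Fin.zero) (s ∘ Fin.suc) (λ b → mono (s≤s z≤n)) (mono ∘ s≤s) a ⟩
  s (Fin.suc a) ∎
  where open ≤-Reasoning

-- The root and the i-th chain force a difference in size of at least h, whereas sets in h
-- consecutive layers differ in size by at most h - 1.
layers-free : ∀ {k} (ℓ : Fin k → ℕ) i → 0 < ℓ i ∸ 1 → ∀ (s : ℤ) → fan ℓ -free (Layers {n} s (ℓ i ∸ 1))
layers-free ℓ i h>0 s (f , inj) = <-irrefl refl (begin-strict
  ∣ f₀ ∣ + h                ≤⟨ m≤m+n (∣ f₀ ∣ + h) (toℕ j₀) ⟩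
  ∣ f₀ ∣ + h + toℕ j₀       ≤⟨ +-monoˡ-≤ (toℕ j₀) top≥ ⟩
  ∣ top ∣ + toℕ j₀          ≡⟨ ℤ.+-injective same ⟩
  ∣ f₀ ∣ + toℕ j₁           <⟨ +-monoʳ-< ∣ f₀ ∣ (Fin.toℕ<n j₁) ⟩
  ∣ f₀ ∣ + h ∎)
  where
  open ≤-Reasoning
  open PosetHomomorphism f using (⟦_⟧; mono)
  h : ℕ
  h = ℓ i ∸ 1
  last : Fin h
  last = Fin.fromℕ< {pred h} (≤-reflexive (suc-pred h {{>-nonZero h>0}}))
  g : Fan ℓ → Subset _
  g = proj₁ ∘ ⟦_⟧
  f₀ top : Subset _
  f₀  = g root
  top = g (node i last)
  j₀ j₁ : Fin h
  j₀ = proj₁ (proj₂ ⟦ root ⟧)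
  j₁ = proj₁ (proj₂ ⟦ node i last ⟧)

  -- Both sides equal s + `j₀` + `j₁`. This removes the possibly negative s, so that sizes can be
  -- compared in ℕ.
  same : ℤ.+ (∣ top ∣ + toℕ j₀) ≡ ℤ.+ (∣ f₀ ∣ + toℕ j₁)
  same = trans (cong (ℤ._+ ℤ.+ toℕ j₀) (proj₂ (proj₂ ⟦ node i last ⟧)))
    (trans (swap s (ℤ.+ toℕ j₁) (ℤ.+ toℕ j₀)) (cong (ℤ._+ ℤ.+ toℕ j₁) (sym (proj₂ (proj₂ ⟦ root ⟧)))))
    where
    swap : ∀ x y z → x ℤ.+ y ℤ.+ z ≡ x ℤ.+ z ℤ.+ y
    swap = solve-∀

  g-< : ∀ {x y} → x ≤ᶠ y → x ≢ y → ∣ g x ∣ < ∣ g y ∣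
  g-< x≤y x≢y = ⊆∧≢⇒∣∣< (mono x≤y) (x≢y ∘ inj)

  node-injective : ∀ {a b} → Fan.node {ℓ = ℓ} i a ≡ node i b → a ≡ b
  node-injective refl = refl

  top≥ : ∣ f₀ ∣ + h ≤ ∣ top ∣
  top≥ = subst (λ m → ∣ f₀ ∣ + m ≤ ∣ top ∣)
    (trans (cong suc (Fin.toℕ-fromℕ< _)) (suc-pred h {{>-nonZero h>0}}))
    (increasing-≥ ∣ f₀ ∣ (λ a → ∣ g (node i a) ∣) (λ a → g-< root≤ λ ())
      (λ a<b → g-< (node≤ (<⇒≤ a<b)) (λ eq → Fin.<-irrefl (node-injective eq) a<b)) last)

∣++∣ : ∀ {m} (A : Subset m) (B : Subset n) → ∣ A Vec.++ B ∣ ≡ ∣ A ∣ + ∣ B ∣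
∣++∣ []            B = refl
∣++∣ (inside  ∷ A) B = cong suc (∣++∣ A B)
∣++∣ (outside ∷ A) B = ∣++∣ A B

++-⊆ : ∀ {m} (A : Subset m) {B B′ : Subset n} → B ⊆ B′ → A Vec.++ B ⊆ A Vec.++ B′
++-⊆ []      B⊆B′ = B⊆B′
++-⊆ (_ ∷ A) B⊆B′ here        = here
++-⊆ (_ ∷ A) B⊆B′ (there x∈)  = there (++-⊆ A B⊆B′ x∈)

initial : ∀ {h} → Fin h → Subset h
initial Fin.zero    = ⊥
initial (Fin.suc a) = inside ∷ initial a

∣initial∣ : ∀ {h} (a : Fin h) → ∣ initial a ∣ ≡ toℕ a
∣initial∣ {suc h} Fin.zero    = ∣⊥∣≡0 h
∣initial∣         (Fin.suc a) = cong suc (∣initial∣ a)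

initial-⊆ : ∀ {h} {a b : Fin h} → a Fin.≤ b → initial a ⊆ initial b
initial-⊆ {a = Fin.zero}              _         = ⊥⊆
initial-⊆ {a = Fin.suc a} {Fin.suc b} (s≤s a≤b) = s⊆s (initial-⊆ {a = a} {b} a≤b)

⁅⁆-injective : ∀ {i j : Fin n} → ⁅ i ⁆ ≡ ⁅ j ⁆ → i ≡ j
⁅⁆-injective {i = i} {j} eq = x∈⁅y⁆⇒x≡y j (subst (i Sub.∈_) eq (x∈⁅x⁆ i))

-- node i a is sent to {i} ∪ {first a elements of a disjoint h-set}.
fan-in-layers : ∀ {k} (ℓ : Fin k → ℕ) h → (∀ i → ℓ i ∸ 1 ≤ h) → ∀ {m} → h < m →
  fan ℓ ⊑ FamilyPoset (Layers {k + h} (ℤ.+ 0) m)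
fan-in-layers {k} ℓ h ℓ≤ {m} h<m = fan-⊑ f (λ x → Fin.fromℕ< (f< x) , cong ℤ.+_ (sym (Fin.toℕ-fromℕ< (f< x)))) mono inj
  where
  place : ∀ i → Fin (ℓ i ∸ 1) → Fin h
  place i a = Fin.inject≤ a (ℓ≤ i)

  f : Fan ℓ → Subset (k + h)
  f root       = ⊥
  f (node i a) = ⁅ i ⁆ Vec.++ initial (place i a)

  ∣node∣ : ∀ i a → ∣ f (node i a) ∣ ≡ suc (toℕ (place i a))
  ∣node∣ i a = trans (∣++∣ ⁅ i ⁆ _) (cong₂ _+_ (∣⁅x⁆∣≡1 i) (∣initial∣ (place i a)))

  f< : ∀ x → ∣ f x ∣ < m
  f< root       = ≤-trans (s≤s (≤-trans (≤-reflexive (∣⊥∣≡0 (k + h))) z≤n)) h<m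
  f< (node i a) = ≤-trans (s≤s (≤-trans (≤-reflexive (∣node∣ i a)) (Fin.toℕ<n (place i a)))) h<m

  mono : ∀ {x y} → x ≤ᶠ y → f x ⊆ f y
  mono root≤                   = ⊥⊆
  mono (node≤ {i} {a} {b} a≤b) = ++-⊆ ⁅ i ⁆ (initial-⊆ {a = place i a} {place i b}
    (subst₂ _≤_ (sym (Fin.toℕ-inject≤ a (ℓ≤ i))) (sym (Fin.toℕ-inject≤ b (ℓ≤ i))) a≤b))

  root≢node : ∀ {i a} → f root ≢ f (node i a)
  root≢node {i} {a} eq with trans (sym (∣⊥∣≡0 (k + h))) (trans (cong ∣_∣ eq) (∣node∣ i a))
  ... | ()

  inj : ∀ {x y} → f x ≡ f y → x ≡ y
  inj {root}     {root}     _  = refl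
  inj {root}     {node i a} eq = contradiction eq (root≢node {i} {a})
  inj {node i a} {root}     eq = contradiction (sym eq) (root≢node {i} {a})
  inj {node i a} {node j b} eq with ⁅⁆-injective (Vec.++-injectiveˡ ⁅ i ⁆ ⁅ j ⁆ eq)
  ... | refl = cong (node i) (Fin.inject≤-injective (ℓ≤ i) (ℓ≤ i) a b (Fin.toℕ-injective
    (suc-injective (trans (sym (∣node∣ i a)) (trans (cong ∣_∣ eq) (∣node∣ i b))))))

fan-e : ∀ {k} (ℓ : Fin k → ℕ) i → 0 < ℓ i ∸ 1 → (∀ j → ℓ j ≤ ℓ i) → IsE (fan ℓ) (ℓ i ∸ 1)
fan-e {k} ℓ i h>0 ℓ≤ = (λ n → layers-free ℓ i h>0) , λ m free → ≮⇒≥ λ h<m →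
  -- The ground set has one element for each chain and h shared elements; the layers start at the
  -- empty set.
  free (k + (ℓ i ∸ 1)) (ℤ.+ 0) (fan-in-layers ℓ (ℓ i ∸ 1) (λ j → ∸-monoˡ-≤ 1 (ℓ≤ j)) h<m)

-- Counting duplicate-free families and unions of layers.

unique-⊆⇒length-≤ : ∀ {xs ys : List X} → Unique xs → (∀ {x} → x ∈ xs → x ∈ ys) → length xs ≤ length ys
unique-⊆⇒length-≤ {xs = []} _ _ = z≤n
unique-⊆⇒length-≤ {xs = x ∷ xs} (x∉ ∷ u) xs⊆ys with ∈-∃++ (xs⊆ys (here refl))
... | as , bs , refl = ≤-trans (s≤s (unique-⊆⇒length-≤ u rest))
  (≤-reflexive (trans (cong suc (length-++-comm as bs)) (length-++-comm (x ∷ bs) as)))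
  where
  rest : ∀ {y} → y ∈ xs → y ∈ as ++ bs
  rest y∈ with ∈-++⁻ as (xs⊆ys (there y∈))
  ... | inj₁ y∈as         = ∈-++⁺ˡ y∈as
  ... | inj₂ (here refl)  = contradiction refl (All.lookup x∉ y∈)
  ... | inj₂ (there y∈bs) = ∈-++⁺ʳ as y∈bs

length-concatMap : ∀ (f : X → List Y) xs → length (concatMap f xs) ≡ ∑ xs (length ∘ f)
length-concatMap f []       = refl
length-concatMap f (x ∷ xs) = trans (length-++ (f x)) (cong (λ m → length (f x) + m) (length-concatMap f xs))

∑-concatMap : ∀ (f : X → List Y) xs g → ∑ (concatMap f xs) g ≡ ∑ xs (λ x → ∑ (f x) g)
∑-concatMap f []       g = refl
∑-concatMap f (x ∷ xs) g = trans (∑-++ (f x) g) (cong (∑ (f x) g +_) (∑-concatMap f xs g))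

length-filter-∑ : ∀ {P : Pred X 0ℓ} (P? : Decidable P) xs → length (filter P? xs) ≡ ∑ xs (𝟙 ∘ P?)
length-filter-∑ P? []       = refl
length-filter-∑ P? (x ∷ xs) with P? x
... | yes _ = cong suc (length-filter-∑ P? xs)
... | no  _ = length-filter-∑ P? xs

-- The level of the j-th layer is a function, so that one definition covers all layers (`id`), the
-- top layers (`n ∸_`) and the layers from the middle upwards (`⌊ n /2⌋ +_`).
layers : ∀ n → (ℕ → ℕ) → ℕ → List (Subset n)
layers n s k = concatMap (layer n ∘ s) (downFrom k)

∈-layers⁺ : ∀ {s k} {A : Subset n} {j} → j < k → ∣ A ∣ ≡ s j → A ∈ layers n s k
∈-layers⁺ {n} {s} {A = A} j<k eq = ∈-concatMap⁺ (layer n ∘ s)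
  (lose (∈-downFrom⁺ j<k) (subst (λ i → A ∈ layer n i) eq (∈-layer A)))

∈-layers⁻ : ∀ {s k} {A : Subset n} → A ∈ layers n s k → ∃[ j ] j < k × ∣ A ∣ ≡ s j
∈-layers⁻ {n} {s} A∈ with find (∈-concatMap⁻ (layer n ∘ s) A∈)
... | j , j∈ , A∈j = j , ∈-downFrom⁻ j∈ , ∈-layer⇒∣∣ n (s j) A∈j

length-layers : ∀ n s k → length (layers n s k) ≡ ∑ (downFrom k) (λ j → n C s j)
length-layers n s k = trans (length-concatMap (layer n ∘ s) (downFrom k))
  (∑-cong (downFrom k) (λ {j} _ → length-layer n (s j)))

unique-layer : ∀ n k → Unique (layer n k)
unique-layer zero    zero    = [] ∷ []
unique-layer zero    (suc k) = []
unique-layer (suc n) zero    = Unique.map⁺ Vec.∷-injectiveʳ (unique-layer n 0)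
unique-layer (suc n) (suc k) = Unique.++⁺
  (Unique.map⁺ Vec.∷-injectiveʳ (unique-layer n k)) (Unique.map⁺ Vec.∷-injectiveʳ (unique-layer n (suc k)))
  λ (A∈ , A∈′) → disjoint (∈-map⁻ _ A∈) (∈-map⁻ _ A∈′)
  where
  disjoint : ∀ {A : Subset (suc n)} {xs ys} → (∃[ B ] B ∈ xs × A ≡ inside ∷ B) → ¬ (∃[ B ] B ∈ ys × A ≡ outside ∷ B)
  disjoint (_ , _ , refl) (_ , _ , ())

unique-layers : ∀ n s k → (∀ {i j} → i < j → s i ≢ s j) → Unique (layers n s k)
unique-layers n s zero    _  = []
unique-layers n s (suc k) s≢ = Unique.++⁺ (unique-layer n (s k)) (unique-layers n s k s≢)
  λ (A∈ , A∈′) → let (j , j<k , eq) = ∈-layers⁻ {s = s} A∈′ in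
    s≢ j<k (trans (sym eq) (∈-layer⇒∣∣ n (s k) A∈))

-- For j < m, `absorption` gives C(n,j) (n - j) = (j + 1) C(n,j+1) ≤ m N, where N is the middle
-- coefficient and n - j ≥ D. Thus m extreme layers hold at most m² N / D sets, negligible for fixed
-- m and growing D.
binomial-tail-≤ : ∀ n m D → m + D ≤ n → ∑ (downFrom m) (λ j → n C j) * D ≤ m * (m * (n C ⌊ n /2⌋))
binomial-tail-≤ n m D m+D≤n = begin
  ∑ (downFrom m) (n C_) * D                ≡⟨ ∑-*ʳ (downFrom m) (n C_) D ⟨
  ∑ (downFrom m) (λ j → (n C j) * D)       ≤⟨ ∑-mono (downFrom m) (λ {j} j∈ → each j (∈-downFrom⁻ j∈)) ⟩
  ∑ (downFrom m) (λ _ → m * N)             ≡⟨ ∑-const (downFrom m) _ ⟩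
  length (downFrom m) * (m * N)            ≡⟨ cong (_* (m * N)) (length-downFrom m) ⟩
  m * (m * N) ∎
  where
  open ≤-Reasoning
  N : ℕ
  N = n C ⌊ n /2⌋
  each : ∀ j → j < m → (n C j) * D ≤ m * N
  each j j<m = begin
    (n C j) * D          ≤⟨ *-monoʳ-≤ (n C j) (m+n≤o⇒m≤o∸n D (≤-trans (≤-reflexive (+-comm D j)) (≤-trans (+-monoˡ-≤ D (<⇒≤ j<m)) m+D≤n))) ⟩
    (n C j) * (n ∸ j)    ≡⟨ *-comm (n C j) (n ∸ j) ⟩
    (n ∸ j) * (n C j)    ≡⟨ absorption n j ⟨
    suc j * (n C suc j)  ≤⟨ *-mono-≤ j<m (C-≤-middle n (suc j)) ⟩
    m * N                ∎

-- Upper bound for fan-free families.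

module _ {k} {ℓ : Fin k → ℕ} {h : ℕ} (ℓ≤ : ∀ i → ℓ i ∸ 1 ≤ h) where

  -- The family is split at size n - m with m = k h + t. Sets up to that size are bounded by
  -- `lubell-≤`, since k petals above a member would give the fan; the larger sets are bounded by
  -- `binomial-tail-≤`. The factor t D clears both denominators.
  free-length-≤ : ∀ {𝓕 : List (Subset n)} → Unique 𝓕 → fan ℓ -free (_∈ 𝓕) →
    ∀ t D → 0 < t → k * h + t + D ≤ n →
    t * D * length 𝓕 ≤ D * ((k * h + t) * (h * (n C ⌊ n /2⌋))) + t * ((k * h + t) * ((k * h + t) * (n C ⌊ n /2⌋)))
  free-length-≤ {n} {𝓕} uniq free t D t>0 m+D≤n = begin
    t * D * length 𝓕
      ≤⟨ *-monoʳ-≤ (t * D) length-≤ ⟩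
    t * D * (low + tail)
      ≡⟨ solve 4 (λ t D l a → t :* D :* (l :+ a) := D :* (t :* l) :+ t :* (a :* D)) refl t D low tail ⟩
    D * (t * low) + t * (tail * D)
      ≤⟨ +-mono-≤ (*-monoʳ-≤ D (lubell-≤ Q? h c t (≤-trans t>0 (m≤n+m t c)) proj₂ blockers)) (*-monoʳ-≤ t (binomial-tail-≤ n m D m+D≤n)) ⟩
    D * (m * (h * (n C ⌊ n /2⌋))) + t * (m * (m * (n C ⌊ n /2⌋))) ∎
    where
    open ≤-Reasoning
    open +-*-Solver
    c m : ℕ
    c = k * h
    m = c + t
    Q : Pred (Subset n) 0ℓ
    Q A = A ∈ 𝓕 × ∣ A ∣ + m ≤ n
    Q? : Decidable Q
    Q? A = (A ∈ˢ? 𝓕) ×-dec (∣ A ∣ + m ≤? n)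

    blockers : ∀ {A} → Q A → ∃[ S ] length S ≤ c × All Q S × Blocks Q h S A
    blockers q with petals-or-blocker Q? k
    ... | inj₂ blocker = blocker
    ... | inj₁ (S , P) = contradiction (petals⇒⊑ P proj₁ (proj₁ q) ℓ≤) free

    low tail : ℕ
    low  = ∑ (downFrom n) (λ k → ∑ (layer n k) (𝟙 ∘ Q?))
    tail = ∑ (downFrom m) (n C_)

    cover : ∀ {A} → A ∈ 𝓕 → A ∈ filter Q? (layers n id n) ++ layers n (n ∸_) m
    cover {A} A∈ with ∣ A ∣ + m ≤? n
    ... | yes low = ∈-++⁺ˡ (∈-filter⁺ Q? (∈-layers⁺ (≤-trans (≤-trans (≤-reflexive (+-comm 1 ∣ A ∣)) (+-monoʳ-≤ ∣ A ∣ (≤-trans t>0 (m≤n+m t c)))) low) refl) (A∈ , low))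
    -- A set with more than n - m elements lies in one of the top m layers, which are indexed by
    -- codimension.
    ... | no high = ∈-++⁺ʳ (filter Q? (layers n id n)) (∈-layers⁺ {j = n ∸ ∣ A ∣}
      (m<n+o⇒m∸n<o n ∣ A ∣ {{>-nonZero (≤-trans t>0 (m≤n+m t c))}} (≰⇒> high)) (sym (m∸[m∸n]≡n (∣p∣≤n A))))

    length-≤ : length 𝓕 ≤ low + tail
    length-≤ = begin
      length 𝓕 ≤⟨ unique-⊆⇒length-≤ uniq cover ⟩
      length (filter Q? (layers n id n) ++ layers n (n ∸_) m)
        ≡⟨ length-++ (filter Q? (layers n id n)) ⟩
      length (filter Q? (layers n id n)) + length (layers n (n ∸_) m)
        -- By symmetry of the binomial coefficients the top m layers are as large as the bottom m.
        ≡⟨ cong₂ _+_ (trans (length-filter-∑ Q? (layers n id n)) (∑-concatMap (layer n) (downFrom n) _))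
             (trans (length-layers n (n ∸_) m) (∑-cong (downFrom m) (λ j∈ → sym (nCk≡nC[n∸k] (<⇒≤ (<-≤-trans (∈-downFrom⁻ j∈) (m+n≤o⇒m≤o m m+D≤n))))))) ⟩
      low + tail ∎

-- Lower bound from the middle layers.

-- With K = ⌊n/2⌋, (K + j + 1) (C(n,K+j) - C(n,K+j+1)) ≤ (2 j + 1) C(n,K); these odd numbers sum to j².
middle-≥ : ∀ n j → (n C ⌊ n /2⌋) * suc ⌊ n /2⌋ ≤ (n C (⌊ n /2⌋ + j)) * suc ⌊ n /2⌋ + j * j * (n C ⌊ n /2⌋)
middle-≥ n zero    = ≤-reflexive (trans (cong (λ i → (n C i) * suc ⌊ n /2⌋) (sym (+-identityʳ ⌊ n /2⌋))) (sym (+-identityʳ _)))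
middle-≥ n (suc j) = begin
  N * suc K                                          ≤⟨ middle-≥ n j ⟩
  (n C (K + j)) * suc K + j * j * N                  ≤⟨ +-monoˡ-≤ (j * j * N) step ⟩
  (n C suc (K + j)) * suc K + (2 * j + 1) * N + j * j * N
    ≡⟨ solve 4 (λ a K j N → a :* (con 1 :+ K) :+ (con 2 :* j :+ con 1) :* N :+ j :* j :* N
         := a :* (con 1 :+ K) :+ (con 1 :+ j) :* (con 1 :+ j) :* N) refl (n C suc (K + j)) K j N ⟩
  (n C suc (K + j)) * suc K + suc j * suc j * N      ≡⟨ cong (λ i → (n C i) * suc K + suc j * suc j * N) (+-suc K j) ⟨
  (n C (K + suc j)) * suc K + suc j * suc j * N ∎
  where
  open ≤-Reasoning
  open +-*-Solver
  K N a b : ℕ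
  K = ⌊ n /2⌋
  N = n C K
  a = n C (K + j)
  b = n C suc (K + j)

  K≤ : suc (K + j) ≤ (n ∸ (K + j)) + (2 * j + 1)
  K≤ = begin
    suc (K + j)                         ≡⟨ solve 2 (λ K j → con 1 :+ (K :+ j) := K :+ (con 1 :+ j)) refl K j ⟩
    K + suc j                           ≤⟨ +-monoˡ-≤ (suc j) (⌊n/2⌋≤⌈n/2⌉ n) ⟩
    ⌈ n /2⌉ + suc j                     ≤⟨ +-monoˡ-≤ (suc j) (m≤n+m∸n ⌈ n /2⌉ j) ⟩
    j + (⌈ n /2⌉ ∸ j) + suc j           ≡⟨ solve 2 (λ e j → j :+ e :+ (con 1 :+ j) := e :+ (con 2 :* j :+ con 1)) refl (⌈ n /2⌉ ∸ j) j ⟩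
    (⌈ n /2⌉ ∸ j) + (2 * j + 1)         ≡⟨ cong (λ e → (e ∸ j) + (2 * j + 1)) (trans (sym (m+n∸m≡n K ⌈ n /2⌉)) (cong (_∸ K) (⌊n/2⌋+⌈n/2⌉≡n n))) ⟩
    (n ∸ K ∸ j) + (2 * j + 1)           ≡⟨ cong (_+ (2 * j + 1)) (∸-+-assoc n K j) ⟩
    (n ∸ (K + j)) + (2 * j + 1) ∎

  weak : a * suc (K + j) ≤ b * suc (K + j) + (2 * j + 1) * N
  weak = begin
    a * suc (K + j)                               ≡⟨ *-comm a _ ⟩
    suc (K + j) * a                               ≤⟨ *-monoˡ-≤ a K≤ ⟩
    ((n ∸ (K + j)) + (2 * j + 1)) * a             ≡⟨ *-distribʳ-+ a (n ∸ (K + j)) (2 * j + 1) ⟩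
    (n ∸ (K + j)) * a + (2 * j + 1) * a           ≤⟨ +-mono-≤ (≤-reflexive (trans (sym (absorption n (K + j))) (*-comm (suc (K + j)) b))) (*-monoʳ-≤ (2 * j + 1) (C-≤-middle n (K + j))) ⟩
    b * suc (K + j) + (2 * j + 1) * N ∎

  step : a * suc K ≤ b * suc K + (2 * j + 1) * N
  -- Only when b ≤ a is there a loss e = a - b; in that case the factor K + j + 1 in `weak` may be
  -- lowered to K + 1.
  step with ≤-total a b
  ... | inj₁ a≤b = m≤n⇒m≤n+o _ (*-monoˡ-≤ (suc K) a≤b)
  ... | inj₂ b≤a with m≤n⇒∃[o]m+o≡n b≤a
  ...   | e , b+e≡a = begin
    a * suc K                        ≡⟨ cong (_* suc K) b+e≡a ⟨
    (b + e) * suc K                  ≡⟨ *-distribʳ-+ (suc K) b e ⟩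
    b * suc K + e * suc K            ≤⟨ +-monoʳ-≤ (b * suc K) (≤-trans (*-monoʳ-≤ e (s≤s (m≤m+n K j))) e≤) ⟩
    b * suc K + (2 * j + 1) * N ∎
    where
    e≤ : e * suc (K + j) ≤ (2 * j + 1) * N
    e≤ = +-cancelˡ-≤ (b * suc (K + j)) _ _ (≤-trans
      (≤-reflexive (trans (sym (*-distribʳ-+ (suc (K + j)) b e)) (cong (_* suc (K + j)) b+e≡a))) weak)

-- Sum of `middle-≥` over j < h, with each j² bounded by h²: the h layers fall short of h N by at
-- most h³ N / (K + 1).
middle-layers-≥ : ∀ n h → h * (n C ⌊ n /2⌋) * suc ⌊ n /2⌋
  ≤ length (layers n (⌊ n /2⌋ +_) h) * suc ⌊ n /2⌋ + h * (h * h) * (n C ⌊ n /2⌋)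
middle-layers-≥ n h = begin
  h * N * suc K                                              ≡⟨ trans (*-assoc h N (suc K)) (cong (_* (N * suc K)) (sym (length-downFrom h))) ⟩
  length (downFrom h) * (N * suc K)                          ≡⟨ ∑-const (downFrom h) _ ⟨
  ∑ (downFrom h) (λ _ → N * suc K)                           ≤⟨ ∑-mono (downFrom h) (λ {j} j∈ → ≤-trans (middle-≥ n j)
      (+-monoʳ-≤ ((n C (K + j)) * suc K) (*-monoˡ-≤ N (let j≤h = <⇒≤ (∈-downFrom⁻ j∈) in *-mono-≤ j≤h j≤h)))) ⟩
  ∑ (downFrom h) (λ j → (n C (K + j)) * suc K + h * h * N)   ≡⟨ ∑-+ (downFrom h) _ _ ⟩
  ∑ (downFrom h) (λ j → (n C (K + j)) * suc K) + ∑ (downFrom h) (λ _ → h * h * N)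
    ≡⟨ cong₂ _+_ (trans (∑-*ʳ (downFrom h) _ (suc K)) (cong (_* suc K) (sym (length-layers n (K +_) h))))
         (trans (∑-const (downFrom h) _) (trans (cong (_* (h * h * N)) (length-downFrom h)) (sym (*-assoc h (h * h) N)))) ⟩
  length (layers n (K +_) h) * suc K + h * (h * h) * N ∎
  where
  open ≤-Reasoning
  K N : ℕ
  K = ⌊ n /2⌋
  N = n C K

free-middle-layers : ∀ {k} (ℓ : Fin k → ℕ) i → 0 < ℓ i ∸ 1 → ∀ n →
  FreeFamilySize (fan ℓ) n (length (layers n (⌊ n /2⌋ +_) (ℓ i ∸ 1)))
free-middle-layers ℓ i h>0 n = layers n (K +_) h ,
  unique-layers n (K +_) h (λ i<j eq → <⇒≢ i<j (+-cancelˡ-≡ K _ _ eq)) ,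
  free-antitone in-layers (layers-free ℓ i h>0 (ℤ.+ K)) , refl
  where
  K h : ℕ
  K = ⌊ n /2⌋
  h = ℓ i ∸ 1
  in-layers : ∀ {A} → A ∈ layers n (K +_) h → Layers (ℤ.+ K) h A
  in-layers A∈ with ∈-layers⁻ {s = K +_} A∈
  ... | j , j<h , eq = Fin.fromℕ< j<h , cong ℤ.+_ (trans eq (cong (λ x → K + x) (sym (Fin.toℕ-fromℕ< j<h))))

-- Decidability of containment and existence of La.

Searchable : (X : Set) → Rel X 0ℓ → Set₁
Searchable X _≈_ = ∀ {P : Pred X 0ℓ} → P Respects _≈_ → Decidable P → Dec (∃ P)

search-subset : Searchable (Subset n) _≡_
search-subset _ P? = anySubset? P?

-- Without function extensionality, functions can only be searched up to pointwise equality.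
search-Π : ∀ {m} {X : Fin m → Set} {_≈_ : ∀ i → Rel (X i) 0ℓ} → (∀ i → Reflexive (_≈_ i)) →
  (∀ i → Searchable (X i) (_≈_ i)) → Searchable (∀ i → X i) (λ f g → ∀ i → _≈_ i (f i) (g i))
search-Π {zero}  {X} rfl search resp P? = map′ (none ,_) (λ (f , p) → resp {f} {none} (λ ()) p) (P? none)
  where
  none : ∀ i → X i
  none ()
search-Π {suc m} {X} {_≈_} rfl search {P} resp P? = map′
  (λ (x , f , p) → cons x f , p)
  (λ (f , p) → f Fin.zero , f ∘ Fin.suc , resp (cons-η f) p)
  (search Fin.zero
    (λ x≈y (f , p) → f , resp (λ { Fin.zero → x≈y ; (Fin.suc i) → rfl (Fin.suc i) }) p)
    (λ x → search-Π (rfl ∘ Fin.suc) (search ∘ Fin.suc)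
      (λ f≈g → resp λ { Fin.zero → rfl Fin.zero ; (Fin.suc i) → f≈g i })
      (P? ∘ cons x)))
  where
  cons : X Fin.zero → (∀ i → X (Fin.suc i)) → ∀ i → X i
  cons x f Fin.zero    = x
  cons x f (Fin.suc i) = f i
  cons-η : ∀ f i → _≈_ i (f i) (cons (f Fin.zero) (f ∘ Fin.suc) i)
  cons-η f Fin.zero    = rfl Fin.zero
  cons-η f (Fin.suc i) = rfl (Fin.suc i)

module _ {k} {ℓ : Fin k → ℕ} where

  all-fan? : {P : Pred (Fan ℓ) 0ℓ} → Decidable P → Dec (∀ x → P x)
  all-fan? P? = map′
    (λ { (r , ns) root → r ; (r , ns) (node i a) → ns i a })
    (λ p → p root , λ i a → p (node i a))
    (P? root ×-dec Fin.all? λ i → Fin.all? λ a → P? (node i a))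

  search-fan : ∀ {n} → Searchable (Fan ℓ → Subset n) _≗_
  search-fan resp P? = map′
    (λ (A , f , p) → fromBranches A f , p)
    (λ (f , p) → f root , (λ i a → f (node i a)) , resp (λ { root → refl ; (node i a) → refl }) p)
    (search-subset (λ { refl q → q }) λ A →
      search-Π (λ _ _ → refl) (λ _ → search-Π (λ _ → refl) (λ _ → search-subset))
        (λ f≈g → resp λ { root → refl ; (node i a) → f≈g i a }) (P? ∘ fromBranches A))
    where
    fromBranches : Subset _ → (∀ i → Fin (ℓ i ∸ 1) → Subset _) → Fan ℓ → Subset _
    fromBranches A f root       = A
    fromBranches A f (node i a) = f i a

  _≟ᶠ_ : DecidableEquality (Fan ℓ)
  root     ≟ᶠ root     = yes refl
  root     ≟ᶠ node j b = no λ ()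
  node i a ≟ᶠ root     = no λ ()
  node i a ≟ᶠ node j b with i Fin.≟ j
  ... | no  i≢j  = no λ { refl → i≢j refl }
  ... | yes refl = map′ (cong (node i)) (λ { refl → refl }) (a Fin.≟ b)

  _≤ᶠ?_ : ∀ (x y : Fan ℓ) → Dec (x ≤ᶠ y)
  root     ≤ᶠ? y        = yes root≤
  node i a ≤ᶠ? root     = no λ ()
  node i a ≤ᶠ? node j b with i Fin.≟ j
  ... | no  i≢j  = no λ { (node≤ _) → i≢j refl }
  ... | yes refl = map′ node≤ (λ { (node≤ a≤b) → a≤b }) (a Fin.≤? b)

  fan-⊑? : (𝓕 : List (Subset n)) → Dec (fan ℓ ⊑ FamilyPoset (_∈ 𝓕))
  fan-⊑? {n} 𝓕 = map′
    (λ (f , f∈ , mono , inj) → fan-⊑ f f∈ (mono _ _) (inj _ _))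
    (λ (f , inj) → let open PosetHomomorphism f using (⟦_⟧; mono) in
      proj₁ ∘ ⟦_⟧ , proj₂ ∘ ⟦_⟧ , (λ _ _ → mono) , (λ _ _ → inj))
    (search-fan {P = Embeds} resp embeds?)
    where
    Embeds : Pred (Fan ℓ → Subset n) 0ℓ
    Embeds f = (∀ x → f x ∈ 𝓕) × (∀ x y → x ≤ᶠ y → f x ⊆ f y) × (∀ x y → f x ≡ f y → x ≡ y)

    embeds? : Decidable Embeds
    embeds? f = all-fan? (λ x → f x ∈ˢ? 𝓕)
      ×-dec all-fan? (λ x → all-fan? λ y → (x ≤ᶠ? y) →-dec (f x ⊆? f y))
      ×-dec all-fan? (λ x → all-fan? λ y → (f x ≟ˢ f y) →-dec (x ≟ᶠ y))

    resp : Embeds Respects _≗_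
    resp {f} {g} f≗g (f∈ , mono , inj) =
      (λ x → subst (_∈ 𝓕) (f≗g x) (f∈ x)) ,
      (λ x y x≤y → subst₂ (λ A B → A ⊆ B) (f≗g x) (f≗g y) (mono x y x≤y)) ,
      (λ x y gx≡gy → inj x y (trans (f≗g x) (trans gx≡gy (sym (f≗g y)))))

  -- A family of m sets is searched for as a function on `Fin m`; the predicate speaks of its
  -- tabulation, which depends only on the pointwise values.
  freeFamilySize? : ∀ n → Decidable (FreeFamilySize (fan ℓ) n)
  freeFamilySize? n m = map′
    (λ (f , u , fr) → tabulate f , u , fr , length-tabulate f)
    (λ { (𝓕 , u , fr , refl) → List.lookup 𝓕 , subst Free (sym (tabulate-lookup 𝓕)) (u , fr) })
    (search-Π (λ _ → refl) (λ _ → search-subset) {P = Free ∘ tabulate}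
      (λ f≗g → subst Free (tabulate-cong f≗g))
      (λ f → unique? (tabulate f) ×-dec ¬? (fan-⊑? (tabulate f))))
    where
    open import Data.List.Relation.Unary.Unique.DecPropositional _≟ˢ_ using (unique?)
    Free : Pred (List (Subset n)) 0ℓ
    Free 𝓕 = Unique 𝓕 × fan ℓ -free (_∈ 𝓕)

maximum : ∀ {P : Pred ℕ 0ℓ} → Decidable P → P 0 → ∀ b → (∀ k → P k → k ≤ b) → ∃ (IsMaximum P)
maximum P? P0 zero    bounded = 0 , P0 , bounded
maximum P? P0 (suc b) bounded with P? (suc b)
... | yes p = suc b , p , bounded
... | no ¬p = maximum P? P0 b λ k pk → s≤s⁻¹ (≤∧≢⇒< (bounded k pk) λ { refl → ¬p pk })

-- The empty family is free because the root needs an image, and no duplicate-free family exceeds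
-- the list of all subsets; the largest size is then found by a finite search.
la : ∀ {k} (ℓ : Fin k → ℕ) n → ∃ (IsLa (fan ℓ) n)
la ℓ n = maximum (freeFamilySize? n) ([] , [] , (λ (f , _) → no-members (proj₂ (PosetHomomorphism.⟦_⟧ f root))) , refl)
  (length (layers n id (suc n))) λ { k (𝓕 , u , _ , refl) →
    unique-⊆⇒length-≤ u (λ {A} _ → ∈-layers⁺ (s≤s (∣p∣≤n A)) refl) }
  where
  no-members : ∀ {A : Subset n} → ¬ A ∈ []
  no-members ()

-- Convergence of the ratio.

-- With q the denominator of ε, the last two hypotheses say that a / N differs from h by less than 1
-- / q. This is at most ε because a positive ε has numerator at least 1.
ratio-close : ∀ a N .{{_ : NonZero N}} h ε → 0ℚ ℚ.< ε →
  a * ℚ.↧ₙ ε < h * N * ℚ.↧ₙ ε + N → h * N * ℚ.↧ₙ ε < a * ℚ.↧ₙ ε + N →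
  ℚ.∣ (ℤ.+ a) ℚ./ N ℚ.- (ℤ.+ h) ℚ./ 1 ∣ ℚ.< ε
ratio-close a N@(suc N-1) h (mkℚ (ℤ.+ zero) _ _) (ℚ.*<* (ℤ.+<+ ())) _ _
ratio-close a N@(suc N-1) h ε@(mkℚ (ℤ.+ p@(suc p-1)) q-1 _) _ a< h< =
  ℚ.toℚᵘ-cancel-< (ℚᵘ.<-respˡ-≃ (ℚᵘ.≃-sym homo) (*<* (subst₂ ℤ._<_ left right (ℤ.+<+ (begin-strict
    ℤ.∣ a ℤ.⊖ (h * N) ∣ * q     <⟨ ∣⊖∣*q< ⟩
    N                           ≤⟨ m≤n*m N p ⟩
    p * N                       ∎)))))
  where
  open ≤-Reasoning
  q : ℕ
  q = suc q-1
  ∣⊖∣*q< : ℤ.∣ a ℤ.⊖ (h * N) ∣ * q < N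
  ∣⊖∣*q< with ≤-total a (h * N)
  ... | inj₁ a≤ = begin-strict
    ℤ.∣ a ℤ.⊖ (h * N) ∣ * q     ≡⟨ cong (_* q) (ℤ.∣⊖∣-≤ a≤) ⟩
    (h * N ∸ a) * q             ≡⟨ *-distribʳ-∸ q (h * N) a ⟩
    h * N * q ∸ a * q           <⟨ m<n+o⇒m∸n<o (h * N * q) (a * q) h< ⟩
    N ∎
  ... | inj₂ ≤a = begin-strict
    ℤ.∣ a ℤ.⊖ (h * N) ∣ * q     ≡⟨ cong (_* q) (trans (ℤ.∣m⊖n∣≡∣n⊖m∣ a (h * N)) (ℤ.∣⊖∣-≤ ≤a)) ⟩
    (a ∸ h * N) * q             ≡⟨ *-distribʳ-∸ q a (h * N) ⟩
    a * q ∸ h * N * q           <⟨ m<n+o⇒m∸n<o (a * q) (h * N * q) a< ⟩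
    N ∎

  difference : ℤ.+ a ℤ.* ℤ.+ 1 ℤ.+ (ℤ.- ℤ.+ h) ℤ.* ℤ.+ N ≡ a ℤ.⊖ (h * N)
  difference = trans (cong₂ ℤ._+_ (ℤ.*-identityʳ (ℤ.+ a))
    (trans (sym (ℤ.neg-distribˡ-* (ℤ.+ h) (ℤ.+ N))) (cong ℤ.-_ (sym (ℤ.pos-* h N)))))
    (ℤ.m-n≡m⊖n a (h * N))

  left : ℤ.+ (ℤ.∣ a ℤ.⊖ (h * N) ∣ * q) ≡ ℤ.+ ℤ.∣ ℤ.+ a ℤ.* ℤ.+ 1 ℤ.+ (ℤ.- ℤ.+ h) ℤ.* ℤ.+ N ∣ ℤ.* ℤ.+ q
  left = trans (ℤ.pos-* ℤ.∣ a ℤ.⊖ (h * N) ∣ q) (cong (λ x → ℤ.+ ℤ.∣ x ∣ ℤ.* ℤ.+ q) (sym difference))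

  right : ℤ.+ (p * N) ≡ ℤ.+ p ℤ.* ℤ.+ (N * 1)
  right = trans (cong (λ x → ℤ.+ (p * x)) (sym (*-identityʳ N))) (ℤ.pos-* p (N * 1))

  homo : ℚ.toℚᵘ ℚ.∣ (ℤ.+ a) ℚ./ N ℚ.- (ℤ.+ h) ℚ./ 1 ∣ ℚᵘ.≃ ℚᵘ.∣ mkℚᵘ (ℤ.+ a) N-1 ℚᵘ.- mkℚᵘ (ℤ.+ h) 0 ∣
  homo = ℚᵘ.≃-trans (ℚ.toℚᵘ-homo-∣-∣ (a/N ℚ.- h/1)) (ℚᵘ.∣-∣-cong
    (ℚᵘ.≃-trans (ℚ.toℚᵘ-homo-+ a/N (ℚ.- h/1)) (ℚᵘ.+-cong (ℚ.toℚᵘ-fromℚᵘ (mkℚᵘ (ℤ.+ a) N-1))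
      (ℚᵘ.≃-trans (ℚ.toℚᵘ-homo‿- h/1) (ℚᵘ.-‿cong (ℚ.toℚᵘ-fromℚᵘ (mkℚᵘ (ℤ.+ h) 0)))))))
    where
    a/N h/1 : ℚ
    a/N = (ℤ.+ a) ℚ./ N
    h/1 = (ℤ.+ h) ℚ./ 1

module _ {k : ℕ} (ℓ : Fin k → ℕ) (i : Fin k) (h>0 : 0 < ℓ i ∸ 1) (ℓ≤ : ∀ j → ℓ j ≤ ℓ i) where

  private
    h : ℕ
    h = ℓ i ∸ 1

  -- t makes h c / t, and then D₀ makes m² / (n ∸ m), smaller than 1 / (2 q).
  la-upper : ∀ q → ∃[ N₀ ] ∀ n {L} → N₀ ≤ n → IsLa (fan ℓ) n L →
    L * q < h * (n C ⌊ n /2⌋) * q + n C ⌊ n /2⌋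
  la-upper q = m + D₀ , bound
    where
    t m D₀ : ℕ
    t  = 1 + 2 * (q * (h * (k * h)))
    m  = k * h + t
    D₀ = 1 + 2 * (q * (m * m))

    bound : ∀ n {L} → m + D₀ ≤ n → IsLa (fan ℓ) n L → L * q < h * (n C ⌊ n /2⌋) * q + n C ⌊ n /2⌋
    bound n {L} m+D₀≤n ((𝓕 , uniq , free , refl) , _) = *-cancelˡ-< (2 * (t * D)) _ _ (begin-strict
      2 * (t * D) * (L * q)
        ≡⟨ solve 4 (λ t D L q → con 2 :* (t :* D) :* (L :* q) := con 2 :* q :* (t :* D :* L)) refl t D L q ⟩
      2 * q * (t * D * L)
        ≤⟨ *-monoʳ-≤ (2 * q) (free-length-≤ (λ j → ∸-monoˡ-≤ 1 (ℓ≤ j)) uniq free t D (s≤s z≤n) m+D≤n) ⟩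
      2 * q * (D * (m * (h * N)) + t * (m * (m * N)))
        -- The added D N and t N supply the summand 1 in `t` and in `D₀`: D N (1 + 2 q h c) = D N
        -- `t` and t N (1 + 2 q m²) = t N `D₀`. Their positivity makes the inequality strict.
        <⟨ m<m+n _ {t * N + D * N} (≤-trans (*-mono-≤ {1} {D} D>0 N>0) (m≤n+m (D * N) (t * N))) ⟩
      2 * q * (D * (m * (h * N)) + t * (m * (m * N))) + (t * N + D * N)
        ≡⟨ solve 7 (λ q D c h N t m →
             con 2 :* q :* (D :* ((c :+ t) :* (h :* N)) :+ t :* (m :* (m :* N))) :+ (t :* N :+ D :* N)
             := con 2 :* (t :* D) :* (h :* N :* q) :+ D :* N :* (con 1 :+ con 2 :* (q :* (h :* c)))
                :+ t :* N :* (con 1 :+ con 2 :* (q :* (m :* m)))) refl q D (k * h) h N t m ⟩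
      2 * (t * D) * (h * N * q) + D * N * t + t * N * D₀
        ≤⟨ +-monoʳ-≤ _ (*-monoʳ-≤ (t * N) D₀≤D) ⟩
      2 * (t * D) * (h * N * q) + D * N * t + t * N * D
        ≡⟨ solve 4 (λ t D x N → con 2 :* (t :* D) :* x :+ D :* N :* t :+ t :* N :* D := con 2 :* (t :* D) :* (x :+ N)) refl t D (h * N * q) N ⟩
      2 * (t * D) * (h * N * q + N) ∎)
      where
      open ≤-Reasoning
      open +-*-Solver
      D N : ℕ
      D = n ∸ m
      N = n C ⌊ n /2⌋
      N>0 : 0 < N
      N>0 = nCk>0 (⌊n/2⌋≤n n)
      D₀≤D : D₀ ≤ D
      D₀≤D = ≤-trans (≤-reflexive (sym (m+n∸m≡n m D₀))) (∸-monoˡ-≤ m m+D₀≤n)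
      D>0 : 0 < D
      D>0 = ≤-trans (s≤s z≤n) D₀≤D
      m+D≤n : m + D ≤ n
      m+D≤n = ≤-reflexive (m+[n∸m]≡n (≤-trans (m≤m+n m D₀) m+D₀≤n))

  -- The fan-free middle layers lose at most h³ N / (K + 1) with K = ⌊n/2⌋. For n ≥ 2 x with x = q
  -- h³ one has K ≥ x, so q times the loss is less than N.
  la-lower : ∀ q → ∃[ N₀ ] ∀ n {L} → N₀ ≤ n → IsLa (fan ℓ) n L →
    h * (n C ⌊ n /2⌋) * q < L * q + n C ⌊ n /2⌋
  la-lower q = x + x , bound
    where
    x : ℕ
    x = q * (h * (h * h))

    bound : ∀ n {L} → x + x ≤ n → IsLa (fan ℓ) n L → h * (n C ⌊ n /2⌋) * q < L * q + n C ⌊ n /2⌋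
    bound n {L} 2x≤n (_ , max) = *-cancelʳ-< (suc K) _ _ (begin-strict
      h * N * q * suc K
        ≡⟨ solve 3 (λ a q s → a :* q :* s := q :* (a :* s)) refl (h * N) q (suc K) ⟩
      q * (h * N * suc K)
        ≤⟨ *-monoʳ-≤ q (≤-trans (middle-layers-≥ n h) (+-monoˡ-≤ _ (*-monoˡ-≤ (suc K) (max _ (free-middle-layers ℓ i h>0 n))))) ⟩
      q * (L * suc K + h * (h * h) * N)
        ≡⟨ solve 5 (λ q L s y N → q :* (L :* s :+ y :* N) := L :* q :* s :+ N :* (q :* y)) refl q L (suc K) (h * (h * h)) N ⟩
      L * q * suc K + N * x
        <⟨ +-monoʳ-< (L * q * suc K) (*-monoʳ-< N (s≤s x≤K)) ⟩
      L * q * suc K + N * suc K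
        ≡⟨ *-distribʳ-+ (suc K) (L * q) N ⟨
      (L * q + N) * suc K ∎)
      where
      open ≤-Reasoning
      open +-*-Solver
      K N : ℕ
      K = ⌊ n /2⌋
      N = n C K
      instance _ = >-nonZero (nCk>0 (⌊n/2⌋≤n n))
      x≤K : x ≤ K
      x≤K = ≤-trans (≤-reflexive (n≡⌊n+n/2⌋ x)) (⌊n/2⌋-mono 2x≤n)

  fan-π : Isπ (fan ℓ) (ℤ.+ h ℚ./ 1)
  fan-π = (λ n → proj₁ (la ℓ n)) , (λ n → proj₂ (la ℓ n)) , λ ε ε>0 →
    let (N₁ , upper) = la-upper (ℚ.↧ₙ ε)
        (N₂ , lower) = la-lower (ℚ.↧ₙ ε)
    in N₁ + N₂ , λ n N≤n →
      ratio-close (proj₁ (la ℓ n)) (n C ⌊ n /2⌋) {{>-nonZero (nCk>0 (⌊n/2⌋≤n n))}} h ε ε>0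
        (upper n (≤-trans (m≤m+n N₁ N₂) N≤n) (proj₂ (la ℓ n)))
        (lower n (≤-trans (m≤n+m N₂ N₁) N≤n) (proj₂ (la ℓ n)))

open import Data.Integer.Base using (+_)
open import Data.Rational.Base using (_/_)

corollary5p2 : ∀ (k : ℕ) (ℓ : Fin (suc k) → ℕ) →
    (∀ i j → i Fin.≤ j → ℓ j ≤ ℓ i) →
    (∀ i → 2 ≤ ℓ i) →
    Isπ (fan ℓ) (+ (ℓ Fin.zero ∸ 1) / 1) × IsE (fan ℓ) (ℓ Fin.zero ∸ 1)
corollary5p2 k ℓ ℓ-antitone 2≤ℓ = fan-π ℓ Fin.zero h>0 ℓ≤ , fan-e ℓ Fin.zero h>0 ℓ≤
  where
  h>0 : 0 < ℓ Fin.zero ∸ 1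
  h>0 = ∸-monoˡ-≤ 1 (2≤ℓ Fin.zero)

  ℓ≤ : ∀ j → ℓ j ≤ ℓ Fin.zero
  ℓ≤ j = ℓ-antitone Fin.zero j z≤n
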